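{- For all $n\ge 2$, $$\left|\mathrm{Av}_n[\overline{23}14]\right|=\sum_{i=0}^{n-2}\binom{n-2}{i}A_i,$$ where $A_i$ is the number of strongly monotone partitions of $[i]$ (with $A_0=1$).
   Context: For $\sigma\in S_n$, the cyclic permutation $[\sigma]$ is the set of all rotations of $\sigma$; $[S_n]$ is the set of cyclic permutations of length $n$. $[\sigma]$ contains the vincular cyclic pattern $[\overline{23}14]$ if some rotation of $\sigma$ has a subsequence $xyzw$ order-isomorphic to $2314$ with $x,y$ in adjacent positions of that rotation; otherwise it avoids it. $\mathrm{Av}_n[\overline{23}14]$ is the set of $[\sigma]\in[S_n]$ avoiding $[\overline{23}14]$. A set partition of $[i]$ is strongly monotone if, when its blocks are listed so that their minimum elements are increasing, their maximum elements are also increasing. $A_i$ counts strongly monotone partitions of $[i]$; $A_0=A_1=1$. -}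

module Defs where

open import Data.Bool using (Bool; true; false; _∧_; _∨_; not)
open import Data.Nat using (ℕ; zero; suc; _+_; _*_; _∸_; _<ᵇ_; _≡ᵇ_; _≤ᵇ_)
open import Data.List using (List; []; _∷_; length; map; concatMap; filterᵇ; upTo; drop; take; _++_)
open import Data.Bool.ListAction using (all; any)
open import Data.Nat.ListAction using (sum)
open import Data.Nat.Combinatorics using (_C_)

words : ℕ → ℕ → List (List ℕ)
words m zero    = [] ∷ []
words m (suc k) = concatMap (λ a → map (a ∷_) (words m k)) (upTo m)

-- Entry at position i (0-based); positions used below are always in range.
at : List ℕ → ℕ → ℕ
at []       _       = 0
at (x ∷ xs) zero    = x
at (x ∷ xs) (suc i) = at xs i

count : {A : Set} → (A → Bool) → List A → ℕ
count p xs = length (filterᵇ p xs)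

isPerm : ℕ → List ℕ → Bool
isPerm n w =
  (length w ≡ᵇ n) ∧ all (λ x → x <ᵇ n) w ∧
  all (λ i → all (λ j → (i ≡ᵇ j) ∨ not (at w i ≡ᵇ at w j)) (upTo n)) (upTo n)

perms : ℕ → List (List ℕ)
perms n = filterᵇ (isPerm n) (words n n)

rotate : ℕ → List ℕ → List ℕ
rotate k w = drop k w ++ take k w

-- all rotations of w (the elements of the cyclic permutation [w])
rotations : List ℕ → List (List ℕ)
rotations w = map (λ k → rotate k w) (upTo (length w))

-- the (linear) word w has a subsequence x y z w order-isomorphic to 2314
-- with x, y in adjacent positions: positions i, i+1, j, k with i+1 < j < k
-- and  w_j < w_i < w_{i+1} < w_k   (z < x < y < w, i.e. pattern 2 3 1 4).
contains-23-14 : List ℕ → Bool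
contains-23-14 w =
  any (λ i → any (λ j → any (λ k →
        (suc i <ᵇ j) ∧ (j <ᵇ k) ∧
        (at w j <ᵇ at w i) ∧ (at w i <ᵇ at w (suc i)) ∧ (at w (suc i) <ᵇ at w k))
      (upTo n)) (upTo n)) (upTo n)
  where n = length w

cyc-contains-23-14 : List ℕ → Bool
cyc-contains-23-14 w = any contains-23-14 (rotations w)

-- Every cyclic permutation [σ] ∈ [S_n] (n ≥ 1) has exactly one rotation
-- starting with the smallest value 0; we use it as the representative.
isCycRep : List ℕ → Bool
isCycRep []       = false
isCycRep (x ∷ _)  = x ≡ᵇ 0

numAvCyc-23-14 : ℕ → ℕ
numAvCyc-23-14 n =
  count (λ w → isCycRep w ∧ not (cyc-contains-23-14 w)) (perms n)

-- Set partitions of [i], encoded as restricted growth strings: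
-- w_t = index (0-based) of the block containing t+1, where blocks are
-- numbered in increasing order of their minimum elements.

maxL : List ℕ → ℕ
maxL []       = 0
maxL (x ∷ xs) = Data.Nat._⊔_ x (maxL xs)

isRGS : List ℕ → Bool
isRGS w = all (λ t → at w t ≤ᵇ bound t) (upTo (length w))
  where
  bound : ℕ → ℕ
  bound zero    = 0
  bound (suc t) = suc (maxL (take (suc t) w))

nBlocks : List ℕ → ℕ
nBlocks []  = 0
nBlocks w@(_ ∷ _) = suc (maxL w)

lastPos : List ℕ → ℕ → ℕ
lastPos w b = go (upTo (length w))
  where
  go : List ℕ → ℕ
  go []       = 0
  go (t ∷ ts) = if at w t ≡ᵇ b then Data.Nat._⊔_ t (go ts) else go ts
    where open import Data.Bool using (if_then_else_)

-- strongly monotone: blocks ordered by minima have increasing maxima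
isStronglyMonotone : List ℕ → Bool
isStronglyMonotone w =
  all (λ a → all (λ b → not (a <ᵇ b) ∨ (lastPos w a <ᵇ lastPos w b))
        (upTo (nBlocks w))) (upTo (nBlocks w))

A : ℕ → ℕ
A i = count (λ w → isRGS w ∧ isStronglyMonotone w) (words i i)

binomA : ℕ → ℕ
binomA m = sum (map (λ i → (m C i) * A i) (upTo (suc m)))

{-# OPTIONS --safe #-}
module Submission where

-- Write the cyclic permutation as a word starting with 0. It avoids the cyclic pattern iff the word
-- avoids both the linear 23-1-4 and the linear 4-23: cyclically, the initial 0 can serve as the
-- letter 1. Avoiding 4-23 says that every ascent top is a left-to-right maximum, so the maximal
-- decreasing runs are the blocks of a partition listed by increasing maxima; avoiding 23-1-4 then
-- says that the minima of all blocks but the last increase. The last block is the one containing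
-- the largest value and {0} is the first, so what remains is an arbitrary subset of the other n ∸ 2
-- values carrying a strongly monotone partition.
--
-- Such a partition is encoded by the list of the block labels of the values 1, …, n ∸ 2, with
-- nothing for the last block; the word is recovered by sorting the values by increasing label,
-- and by decreasing value within a block.

open import Defs
open import Data.Bool using (Bool; true; false; T; not; _∧_; _∨_)
open import Data.Bool.ListAction using (all; any)
open import Data.Bool.Properties using (T-∧; T-∨)
open import Data.Empty using (⊥; ⊥-elim)
open import Data.List
  using (List; []; _∷_; _++_; length; map; concatMap; filterᵇ; upTo; applyUpTo; drop; take; catMaybes)
open import Data.List.Membership.Propositional using (_∈_; find; lose)
open import Data.List.Membership.Propositional.Properties
open import Data.List.Properties
  using ( length-map; length-upTo; length-applyUpTo; length-++; length-take; length-drop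
        ; length-catMaybes; map-cong; ∷-injective)
open import Data.List.Relation.Unary.All as All using (All; []; _∷_)
open import Data.List.Relation.Unary.All.Properties using (all⁺; all⁻)
open import Data.List.Relation.Unary.AllPairs as AllPairs using (AllPairs; []; _∷_)
import Data.List.Relation.Unary.AllPairs.Properties as AllPairsₚ
open import Data.List.Relation.Unary.Any using (here; there; any?)
open import Data.List.Relation.Unary.Any.Properties using (any⁺; any⁻)
open import Data.List.Relation.Unary.Unique.Propositional using (Unique)
import Data.List.Relation.Unary.Unique.Propositional.Properties as Uniqueₚ
open import Data.Maybe using (Maybe; just; nothing; maybe′)
open import Data.Nat
open import Data.Nat.Combinatorics using (_C_; k>n⇒nCk≡0; nCk≡nC[n∸k]; nCn≡1; nCk+nC[k+1]≡[n+1]C[k+1])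
open import Data.Nat.Induction using (<-wellFounded)
open import Data.Nat.ListAction using (sum)
open import Data.Nat.Properties
open import Data.Product using (∃-syntax; _×_; _,_; proj₁; proj₂)
open import Data.Sum using (_⊎_; inj₁; inj₂; map₂)
open import Function using (_∘_)
open import Function.Bundles using (Equivalence)
open import Induction.WellFounded using (Acc; acc)
open import Relation.Binary.Definitions using (tri<; tri≈; tri>)
open import Relation.Binary.PropositionalEquality using (_≡_; _≢_; refl; sym; trans; cong; cong₂; subst; subst₂)
open import Relation.Nullary using (¬_; yes; no)
open import Relation.Nullary.Decidable using (T?)

open Equivalence using (to; from)

private variable
  X Y : Set

-- Permutations as functions, avoidance conditions and labelled partitions

record IsBijection (n : ℕ) (f : ℕ → ℕ) : Set where
  field
    f<n   : ∀ {i} → i < n → f i < n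
    inj   : ∀ {i j} → i < n → j < n → f i ≡ f j → i ≡ j
    pos   : ℕ → ℕ
    pos<n : ∀ {v} → v < n → pos v < n
    f-pos : ∀ {v} → v < n → f (pos v) ≡ v

  pos-f : ∀ {i} → i < n → pos (f i) ≡ i
  pos-f i<n = inj (pos<n (f<n i<n)) i<n (f-pos (f<n i<n))

record Good (n : ℕ) (f : ℕ → ℕ) : Set where
  field
    starts-at-0 : f 0 ≡ 0
    no-23-1-4   : ∀ {i j k} → suc i < j → j < k → k < n →
                  f j < f i → f i < f (suc i) → ¬ f (suc i) < f k
    no-4-23     : ∀ {a i} → a < i → suc i < n → f i < f (suc i) → ¬ f (suc i) < f a

-- lab v is the index of the block of v in a partition of {0, …, n ∸ 1} into K + 1 blocks:
-- block 0 is {0}, block K contains n ∸ 1, the maxima increase, and so do the minima of blocks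
-- 0, …, K ∸ 1. Monotonicity of minima and maxima is stated for consecutive blocks only.
record Valid (n : ℕ) (lab : ℕ → ℕ) (K : ℕ) : Set where
  field
    lab-0 : lab 0 ≡ 0
    lab≡0 : ∀ {v} → v < n → lab v ≡ 0 → v ≡ 0
    lab≤K : ∀ {v} → v < n → lab v ≤ K
    lab-top : lab (pred n) ≡ K
    minima-increase : ∀ {v a} → v < n → lab v ≡ suc a → suc a < K → ∃[ u ] u < v × lab u ≡ a
    maxima-increase : ∀ {v} → v < n → lab v < K → ∃[ u ] v < u × u < n × lab u ≡ suc (lab v)

module _ {n lab K} (valid : Valid n lab K) where

  open Valid valid

  -- Iterates `maxima-increase`, climbing one block at a time from the block of `v` to block `b`.
  higher-block-larger : ∀ {v} b → v < n → lab v < b → b ≤ K → ∃[ u ] v < u × u < n × lab u ≡ b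
  higher-block-larger {v} (suc b) v<n lt b≤K with m≤n⇒m<n∨m≡n (≤-pred lt)
  ... | inj₂ refl = maxima-increase v<n b≤K
  ... | inj₁ lv<b with higher-block-larger b v<n lv<b (<⇒≤ b≤K)
  ...   | u , v<u , u<n , refl with maxima-increase u<n b≤K
  ...     | u′ , u<u′ , u′<n , e = u′ , <-trans v<u u<u′ , u′<n , e

-- The sorting order of a labelled partition, and decreasing runs

data Before (lab : ℕ → ℕ) (u v : ℕ) : Set where
  lower-block : lab u < lab v → Before lab u v
  same-block  : lab u ≡ lab v → v < u → Before lab u v

module _ {lab : ℕ → ℕ} where

  before-asym : ∀ {u v} → Before lab u v → ¬ Before lab v u
  before-asym (lower-block p) (lower-block q) = <-asym p q
  before-asym (lower-block p) (same-block e _) = <-irrefl (sym e) p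
  before-asym (same-block e _) (lower-block q) = <-irrefl (sym e) q
  before-asym (same-block _ p) (same-block _ q) = <-asym p q

  before-irrefl : ∀ {u} → ¬ Before lab u u
  before-irrefl p = before-asym p p

  before-trans : ∀ {u v w} → Before lab u v → Before lab v w → Before lab u w
  before-trans (lower-block p) (lower-block q) = lower-block (<-trans p q)
  before-trans (lower-block p) (same-block e _) = lower-block (<-≤-trans p (≤-reflexive e))
  before-trans (same-block e _) (lower-block q) = lower-block (≤-<-trans (≤-reflexive e) q)
  before-trans (same-block e p) (same-block e′ q) = same-block (trans e e′) (<-trans q p)

  before-total : ∀ u v → u ≢ v → Before lab u v ⊎ Before lab v u
  before-total u v u≢v with <-cmp (lab u) (lab v) | <-cmp u v
  ... | tri< p _ _ | _ = inj₁ (lower-block p)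
  ... | tri> _ _ p | _ = inj₂ (lower-block p)
  ... | tri≈ _ e _ | tri< p _ _ = inj₂ (same-block (sym e) p)
  ... | tri≈ _ e _ | tri≈ _ p _ = ⊥-elim (u≢v p)
  ... | tri≈ _ e _ | tri> _ _ p = inj₁ (same-block e p)

  before⇒≤ : ∀ {u v} → Before lab u v → lab u ≤ lab v
  before⇒≤ (lower-block p) = <⇒≤ p
  before⇒≤ (same-block e _) = ≤-reflexive e

  -- Inside a block the order lists larger values first, so an increase in value can only come from
  -- a change of block.
  before∧<⇒< : ∀ {u v} → Before lab u v → u < v → lab u < lab v
  before∧<⇒< (lower-block p) _ = p
  before∧<⇒< (same-block _ p) q = ⊥-elim (<-asym p q)

-- The number of ascents before a position; for injective `f` this numbers the maximal decreasing
-- runs from 0.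
runIndex : (ℕ → ℕ) → ℕ → ℕ
runIndex f zero = 0
runIndex f (suc p) with f p <? f (suc p)
... | yes _ = suc (runIndex f p)
... | no  _ = runIndex f p

module _ (f : ℕ → ℕ) where

  private d = runIndex f

  runIndex-asc : ∀ p → f p < f (suc p) → d (suc p) ≡ suc (d p)
  runIndex-asc p lt with f p <? f (suc p)
  ... | yes _ = refl
  ... | no ¬p = ⊥-elim (¬p lt)

  runIndex-step : ∀ p → d p ≤ d (suc p)
  runIndex-step p with f p <? f (suc p)
  ... | yes _ = n≤1+n _
  ... | no _ = ≤-refl

  runIndex-mono : ∀ {p q} → p ≤ q → d p ≤ d q
  runIndex-mono {p} {q} p≤q = go (≤⇒≤′ p≤q)
    where
    go : ∀ {q} → p ≤′ q → d p ≤ d q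
    go (≤′-reflexive refl) = ≤-refl
    go (≤′-step {q} r) = ≤-trans (go r) (runIndex-step q)

  -- `d` grows only at ascents. Its first growth after `p` is at the ascent whose bottom is the last
  -- entry of the run of `p`.
  next-ascent : ∀ {p} q → p ≤ q → d p < d q →
                ∃[ i ] p ≤ i × i < q × f i < f (suc i) × d i ≡ d p
  next-ascent {p} zero z≤n lt = ⊥-elim (<-irrefl refl lt)
  next-ascent {p} (suc q) p≤sq lt with m≤n⇒m<n∨m≡n p≤sq
  ... | inj₂ refl = ⊥-elim (<-irrefl refl lt)
  ... | inj₁ (s≤s p≤q) with m≤n⇒m<n∨m≡n (runIndex-mono p≤q)
  ...   | inj₁ dp<dq = let i , a , b , c , e = next-ascent q p≤q dp<dq in i , a , m<n⇒m<1+n b , c , e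
  ...   | inj₂ dp≡dq with f q <? f (suc q)
  ...     | yes asc = q , p≤q , n<1+n q , asc , sym dp≡dq
  ...     | no _ = ⊥-elim (<-irrefl dp≡dq lt)

  -- The ascent found leads into the run of `p`: its bottom is the last entry of the preceding run,
  -- its top the first entry of the run itself.
  previous-ascent : ∀ p {a} → d p ≡ suc a →
                    ∃[ i ] i < p × f i < f (suc i) × d i ≡ a
  previous-ascent zero ()
  previous-ascent (suc p) e with f p <? f (suc p)
  ... | yes asc = p , n<1+n p , asc , suc-injective e
  ... | no _ = let i , i<p , r = previous-ascent p e in i , m<n⇒m<1+n i<p , r

-- From a labelled partition to an avoiding word

module Sorted⇒Good {n lab K f} (bij : IsBijection n f) (valid : Valid n lab K)
  (sorted : ∀ {i j} → i < j → j < n → Before lab (f i) (f j)) (0<n : 0 < n) where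

  open IsBijection bij
  open Valid valid

  private
    before⇒< : ∀ {i j} → i < n → j < n → Before lab (f i) (f j) → i < j
    before⇒< {i} {j} i<n j<n b with <-cmp i j
    ... | tri< p _ _ = p
    ... | tri≈ _ refl _ = ⊥-elim (before-irrefl b)
    ... | tri> _ _ p = ⊥-elim (before-asym b (sorted p i<n))

    -- A value strictly between two neighbours in the sorted order would have a position strictly
    -- between `i` and `suc i`.
    nothing-between : ∀ {i u} → suc i < n → u < n → Before lab (f i) u → ¬ Before lab u (f (suc i))
    nothing-between {i} {u} si<n u<n b₁ b₂ = <-irrefl refl (<-≤-trans p (≤-pred q))
      where
      p : i < pos u
      p = before⇒< (m+n≤o⇒n≤o 1 si<n) (pos<n u<n) (subst (Before lab (f i)) (sym (f-pos u<n)) b₁)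
      q : pos u < suc i
      q = before⇒< (pos<n u<n) si<n (subst (λ z → Before lab z (f (suc i))) (sym (f-pos u<n)) b₂)

    -- Iterates `minima-increase` downwards; `a < K` is required because the minimum of the last
    -- block is unconstrained.
    lower-block-smaller : ∀ {b v} a → v < n → lab v ≡ a → a < K → b < a → ∃[ u ] u < v × lab u ≡ b
    lower-block-smaller {b} (suc a) v<n e a<K b<a with minima-increase v<n e a<K
    ... | u , u<v , lu with m≤n⇒m<n∨m≡n (≤-pred b<a)
    ...   | inj₂ refl = u , u<v , lu
    ...   | inj₁ b<a′ = let u′ , u′<u , r = lower-block-smaller a (<-trans u<v v<n) lu (m+n≤o⇒n≤o 1 a<K) b<a′
                        in u′ , <-trans u′<u u<v , r

    -- f (suc i) is then the maximum of its block.
    below-ascent-top : ∀ {i x} → suc i < n → lab (f i) < lab (f (suc i)) → x < n →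
                       lab x < lab (f (suc i)) → x < f (suc i)
    below-ascent-top {i} {x} si<n asc x<n lx
      with higher-block-larger valid (lab (f (suc i))) x<n lx (lab≤K (f<n si<n))
    ... | u , x<u , u<n , e = <-≤-trans x<u (≮⇒≥ λ y<u →
          nothing-between si<n u<n (lower-block (subst (lab (f i) <_) (sym e) asc)) (same-block e y<u))

    adjacent : ∀ {i} → suc i < n → Before lab (f i) (f (suc i))
    adjacent = sorted (n<1+n _)

  -- Block 0 is {0} and comes first in the sorted order, so no other value can precede 0.
  f0≡0 : f 0 ≡ 0
  f0≡0 with <-cmp 0 (pos 0)
  ... | tri≈ _ e _ = subst (λ z → f z ≡ 0) (sym e) (f-pos 0<n)
  ... | tri< p _ _ with subst (Before lab (f 0)) (f-pos 0<n) (sorted p (pos<n 0<n))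
  ...   | lower-block q = ⊥-elim (n≮0 (subst (lab (f 0) <_) lab-0 q))
  ...   | same-block e _ = lab≡0 (f<n 0<n) (trans e lab-0)

  good : Good n f
  good = record
    { starts-at-0 = f0≡0
    -- Write x, y for the ascent and z, w for the letters 1 and 4. As z < w, the block of z is not
    -- the last, so minima increase up to it, and the lower block of x contains some u < z < x. In
    -- the sorted order this u lies between x and y, which are neighbours.
    ; no-23-1-4 = λ {i} {j} {k} i<j j<k k<n z<x x<y y<w →
        let j<n    = <-trans j<k k<n
            si<n   = <-trans i<j j<n
            i<n    = m+n≤o⇒n≤o 1 si<n
            asc    = before∧<⇒< (adjacent si<n) x<y
            lj<lk  = before∧<⇒< (sorted j<k k<n) (<-trans z<x (<-trans x<y y<w))
            lj<K   = <-≤-trans lj<lk (lab≤K (f<n k<n))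
            li<lj  = <-≤-trans asc (before⇒≤ (sorted i<j j<n))
            u , u<z , lu = lower-block-smaller (lab (f j)) (f<n j<n) refl lj<K li<lj
        in nothing-between si<n (<-trans u<z (f<n j<n)) (same-block (sym lu) (<-trans u<z z<x))
             (lower-block (subst (_< lab (f (suc i))) (sym lu) asc))
    -- The letter 4 would stand in a block lower than that of the ascent top, so it is smaller than
    -- this top.
    ; no-4-23 = λ {a} {i} a<i si<n x<y y<w →
        let i<n = m+n≤o⇒n≤o 1 si<n
            asc = before∧<⇒< (adjacent si<n) x<y
        in <-asym y<w (below-ascent-top si<n asc (f<n (<-trans a<i i<n))
             (≤-<-trans (before⇒≤ (sorted a<i i<n)) asc))
    }

  -- The word determines the labels. A label cannot rise without an ascent, as the first entry of a
  -- new block exceeds everything in lower blocks; at an ascent it rises by exactly one, as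
  -- otherwise a member of the skipped block would fit between two neighbours.
  lab≡runIndex : ∀ i → i < n → lab (f i) ≡ runIndex f i
  lab≡runIndex zero _ = trans (cong lab f0≡0) lab-0
  lab≡runIndex (suc i) si<n with lab≡runIndex i (m+n≤o⇒n≤o 1 si<n) | f i <? f (suc i)
  ... | ih | no ¬asc = trans (≤-antisym (≮⇒≥ λ lt → ¬asc (below-ascent-top si<n lt (f<n (m+n≤o⇒n≤o 1 si<n)) lt))
                         (before⇒≤ (adjacent si<n))) ih
  ... | ih | yes asc with before∧<⇒< (adjacent si<n) asc
  ...   | lt = trans (≤-antisym (≮⇒≥ λ gap →
                   let u , _ , u<n , lu = maxima-increase (f<n (m+n≤o⇒n≤o 1 si<n)) (<-≤-trans lt (lab≤K (f<n si<n)))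
                   in nothing-between si<n u<n (lower-block (subst (lab (f i) <_) (sym lu) ≤-refl))
                        (lower-block (subst (_< lab (f (suc i))) (sym lu) gap))) lt) (cong suc ih)

-- From an avoiding word to the partition into its decreasing runs

module Good⇒Valid {n f} (bij : IsBijection n f) (good : Good n f) (0<n : 0 < n) where

  open IsBijection bij
  open Good good

  private d = runIndex f

  runLabel : ℕ → ℕ
  runLabel v = d (pos v)

  private
    pos0≡0 : pos 0 ≡ 0
    pos0≡0 = trans (cong pos (sym starts-at-0)) (pos-f 0<n)

    runLabel-f : ∀ {i} → i < n → runLabel (f i) ≡ d i
    runLabel-f i<n = cong d (pos-f i<n)

    ≮∧<n⇒> : ∀ {i j} → i < j → j < n → ¬ f i < f j → f j < f i
    ≮∧<n⇒> i<j j<n ¬lt = ≤∧≢⇒< (≮⇒≥ ¬lt) λ e → <-irrefl (sym (inj j<n (<-trans i<j j<n) e)) i<j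

    same-run⇒> : ∀ {i} j → i < j → j < n → d i ≡ d j → f j < f i
    same-run⇒> {i} (suc j) (s≤s i≤j) sj<n e with f j <? f (suc j)
    ... | yes asc = ⊥-elim (<-irrefl e (s≤s (runIndex-mono f i≤j)))
    ... | no ¬asc with m≤n⇒m<n∨m≡n i≤j
    ...   | inj₂ refl = ≮∧<n⇒> (n<1+n i) sj<n ¬asc
    ...   | inj₁ i<j = <-trans (≮∧<n⇒> (n<1+n j) sj<n ¬asc) (same-run⇒> j i<j (m+n≤o⇒n≤o 1 sj<n) e)

    -- An earlier value above the ascent top would be the 4 of a 4-23, and injectivity excludes
    -- equality; so ascent tops are left-to-right maxima.
    ascent-top-large : ∀ {i p} → p ≤ i → suc i < n → f i < f (suc i) → f p < f (suc i)
    ascent-top-large {i} {p} p≤i si<n asc with m≤n⇒m<n∨m≡n p≤i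
    ... | inj₂ refl = asc
    ... | inj₁ p<i = ≤∧≢⇒< (≮⇒≥ (no-4-23 p<i si<n asc))
                       λ e → <-irrefl (inj (<-trans p<i (m+n≤o⇒n≤o 1 si<n)) si<n e) (m<n⇒m<1+n p<i)

    suc-pred-n : suc (pred n) ≡ n
    suc-pred-n = suc-pred n {{>-nonZero 0<n}}

    last<n : pred n < n
    last<n = ≤-reflexive suc-pred-n

    ≤last : ∀ {i} → i < n → i ≤ pred n
    ≤last = <⇒≤pred

  sorted : ∀ {i j} → i < j → j < n → Before runLabel (f i) (f j)
  sorted {i} {j} i<j j<n with m≤n⇒m<n∨m≡n (runIndex-mono f (<⇒≤ i<j))
  ... | inj₁ lt = lower-block (subst₂ _<_ (sym (runLabel-f (<-trans i<j j<n))) (sym (runLabel-f j<n)) lt)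
  ... | inj₂ e = same-block (trans (runLabel-f (<-trans i<j j<n)) (trans e (sym (runLabel-f j<n))))
                            (same-run⇒> j i<j j<n e)

  valid : Valid n runLabel (d (pred n))
  valid = record
    { lab-0 = cong d pos0≡0
    ; lab≡0 = lab≡0
    ; lab≤K = λ v<n → runIndex-mono f (≤last (pos<n v<n))
    ; lab-top = lab-top
    ; minima-increase = minima-increase
    ; maxima-increase = maxima-increase
    }
    where
    lab≡0 : ∀ {v} → v < n → runLabel v ≡ 0 → v ≡ 0
    lab≡0 {v} v<n e with <-cmp 0 (pos v)
    ... | tri≈ _ p _ = trans (sym (f-pos v<n)) (trans (cong f (sym p)) starts-at-0)
    ... | tri< p _ _ = ⊥-elim (n≮0 (subst (f (pos v) <_) starts-at-0 (same-run⇒> (pos v) p (pos<n v<n) (sym e))))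
    lab-top : runLabel (pred n) ≡ d (pred n)
    lab-top with m≤n⇒m<n∨m≡n (runIndex-mono f (≤last (pos<n last<n)))
    ... | inj₂ e = e
    -- Were the largest value in an earlier run, the top of the ascent ending that run would exceed
    -- it.
    ... | inj₁ lt with next-ascent f (pred n) (≤last (pos<n last<n)) lt
    ...   | i , p≤i , i<m , asc , _ =
            let si<n = <-≤-trans (s≤s i<m) (≤-reflexive suc-pred-n)
                lt = ascent-top-large p≤i si<n asc
            in ⊥-elim (<-irrefl refl (<-≤-trans (subst (_< f (suc i)) (f-pos last<n) lt) (≤last (f<n si<n))))
    minima-increase : ∀ {v a} → v < n → runLabel v ≡ suc a → suc a < d (pred n) → ∃[ u ] u < v × runLabel u ≡ a
    minima-increase {v} {a} v<n e lt with previous-ascent f (pos v) e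
    -- The witness is the smallest entry of the preceding run, the bottom of the ascent leading into
    -- the run of `v`.
    ... | i , i<p , asc , di = f i , subst (f i <_) (f-pos v<n) fi<fp , trans (runLabel-f i<n) di
      where
      p = pos v
      p<n = pos<n v<n
      i<n = <-trans i<p p<n
      fi<fp : f i < f p
      fi<fp with m≤n⇒m<n∨m≡n i<p
      ... | inj₂ e = subst (λ q → f i < f q) e asc
      ... | inj₁ si<p with f i <? f p
      ...   | yes r = r
      -- The run of `v` is not the last, so a later ascent exists, and its top exceeds `f (suc i)`.
      -- If `v` were below `f i`, then `f i`, `f (suc i)`, `v` and this top would form a 23-1-4.
      ...   | no ¬r with next-ascent f (pred n) (≤last p<n) (subst (_< d (pred n)) (sym e) lt)
      ...     | k , p≤k , k<m , asc′ , _ =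
                let sk<n = <-≤-trans (s≤s k<m) (≤-reflexive suc-pred-n)
                in ⊥-elim (no-23-1-4 si<p (s≤s p≤k) sk<n (≮∧<n⇒> i<p p<n ¬r) asc
                     (ascent-top-large (<⇒≤ (<-≤-trans si<p p≤k)) sk<n asc′))
    maxima-increase : ∀ {v} → v < n → runLabel v < d (pred n) → ∃[ u ] v < u × u < n × runLabel u ≡ suc (runLabel v)
    maxima-increase {v} v<n lt with next-ascent f (pred n) (≤last (pos<n v<n)) lt
    -- The top of the ascent ending the run of `v` opens the next run and is a left-to-right
    -- maximum.
    ... | i , p≤i , i<m , asc , di =
          let si<n = <-≤-trans (s≤s i<m) (≤-reflexive suc-pred-n)
          in f (suc i) , subst (_< f (suc i)) (f-pos v<n) (ascent-top-large p≤i si<n asc) , f<n si<n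
             , trans (runLabel-f si<n) (trans (runIndex-asc f i asc) (cong suc di))

-- Boolean tests, filtered lists and enumerated words

T-not⁻ : ∀ {b} → T (not b) → ¬ T b
T-not⁻ {false} _ ()

T-not⁺ : ∀ {b} → ¬ T b → T (not b)
T-not⁺ {false} _ = _
T-not⁺ {true} ¬b = ¬b _

all-upTo⁻ : ∀ {n} {p : ℕ → Bool} → T (all p (upTo n)) → ∀ {i} → i < n → T (p i)
all-upTo⁻ {n} {p} h i<n = All.lookup (all⁺ p (upTo n) h) (∈-upTo⁺ i<n)

all-upTo⁺ : ∀ {n} {p : ℕ → Bool} → (∀ {i} → i < n → T (p i)) → T (all p (upTo n))
all-upTo⁺ {n} {p} h = all⁻ p (All.tabulate (h ∘ ∈-upTo⁻))

any-upTo⁻ : ∀ {n} {p : ℕ → Bool} → T (any p (upTo n)) → ∃[ i ] i < n × T (p i)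
any-upTo⁻ {n} {p} h = let i , i∈ , pi = find (any⁻ p (upTo n) h) in i , ∈-upTo⁻ i∈ , pi

any-upTo⁺ : ∀ {n i} {p : ℕ → Bool} → i < n → T (p i) → T (any p (upTo n))
any-upTo⁺ {p = p} i<n pi = any⁺ p (lose (∈-upTo⁺ i<n) pi)

∈-filterᵇ⁺ : ∀ {p : X → Bool} {x xs} → x ∈ xs → T (p x) → x ∈ filterᵇ p xs
∈-filterᵇ⁺ {p = p} = ∈-filter⁺ (T? ∘ p)

∈-filterᵇ⁻ : ∀ {p : X → Bool} {x xs} → x ∈ filterᵇ p xs → x ∈ xs × T (p x)
∈-filterᵇ⁻ {p = p} = ∈-filter⁻ (T? ∘ p)

filterᵇ-unique : ∀ (p : X → Bool) {xs} → Unique xs → Unique (filterᵇ p xs)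
filterᵇ-unique p = Uniqueₚ.filter⁺ (T? ∘ p)

concatMap-unique : ∀ {f : X → List Y} {xs} → Unique xs → (∀ x → Unique (f x)) →
                   (∀ {x x′ y} → y ∈ f x → y ∈ f x′ → x ≡ x′) → Unique (concatMap f xs)
concatMap-unique {f = f} {xs} xs! f! disjoint = Uniqueₚ.concat⁺
  (All.tabulate λ ys∈ → let x , _ , e = ∈-map⁻ f ys∈ in subst Unique (sym e) (f! x))
  (AllPairsₚ.map⁺ (AllPairs.map (λ x≢x′ {_} (p , q) → x≢x′ (disjoint p q)) xs!))

module _ {m : ℕ} where

  ∈-words⁺ : ∀ {w} k → length w ≡ k → (∀ {x} → x ∈ w → x < m) → w ∈ words m k
  ∈-words⁺ {[]} zero refl h = here refl
  ∈-words⁺ {x ∷ w} (suc k) e h = ∈-concatMap⁺ (λ a → map (a ∷_) (words m k))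
    (lose (∈-upTo⁺ (h (here refl))) (∈-map⁺ (x ∷_) (∈-words⁺ k (suc-injective e) (h ∘ there))))

  ∈-words⁻ : ∀ {w} k → w ∈ words m k → length w ≡ k × (∀ {x} → x ∈ w → x < m)
  ∈-words⁻ zero (here refl) = refl , λ ()
  ∈-words⁻ (suc k) w∈ with find (∈-concatMap⁻ (λ a → map (a ∷_) (words m k)) {xs = upTo m} w∈)
  ... | a , a∈ , w∈′ with ∈-map⁻ (a ∷_) w∈′
  ...   | v , v∈ , refl = let len , h = ∈-words⁻ k v∈
                          in cong suc len , λ { (here refl) → ∈-upTo⁻ a∈ ; (there x∈) → h x∈ }

  words-unique : ∀ k → Unique (words m k)
  words-unique zero = [] ∷ []
  words-unique (suc k) = concatMap-unique (Uniqueₚ.upTo⁺ m)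
    (λ a → Uniqueₚ.map⁺ (proj₂ ∘ ∷-injective) (words-unique k))
    λ p q → let _ , _ , e = ∈-map⁻ _ p ; _ , _ , e′ = ∈-map⁻ _ q in proj₁ (∷-injective (trans (sym e) e′))

-- Positions in lists, counting and permutations

at-∈ : ∀ w {i} → i < length w → at w i ∈ w
at-∈ (x ∷ w) {zero} _ = here refl
at-∈ (x ∷ w) {suc i} (s≤s i<) = there (at-∈ w i<)

∈-at : ∀ {w x} → x ∈ w → ∃[ i ] i < length w × at w i ≡ x
∈-at (here refl) = 0 , s≤s z≤n , refl
∈-at (there x∈) = let i , i< , e = ∈-at x∈ in suc i , s≤s i< , e

AllPairs-at⁺ : ∀ {R : ℕ → ℕ → Set} w → (∀ {i j} → i < j → j < length w → R (at w i) (at w j)) → AllPairs R w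
AllPairs-at⁺ [] h = []
AllPairs-at⁺ {R} (x ∷ w) h =
  All.tabulate (λ y∈ → let j , j< , e = ∈-at y∈ in subst (R x) e (h {0} {suc j} (s≤s z≤n) (s≤s j<)))
  ∷ AllPairs-at⁺ w λ i<j j< → h (s≤s i<j) (s≤s j<)

AllPairs-at⁻ : ∀ {R : ℕ → ℕ → Set} {w} → AllPairs R w → ∀ {i j} → i < j → j < length w → R (at w i) (at w j)
AllPairs-at⁻ {w = x ∷ w} (h ∷ _) {zero} {suc j} _ (s≤s j<) = All.lookup h (at-∈ w j<)
AllPairs-at⁻ {w = x ∷ w} (_ ∷ h) {suc i} {suc j} (s≤s i<j) (s≤s j<) = AllPairs-at⁻ h i<j j<

-- Only distinctness of the first list is needed: matched elements of ys are removed one by one.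
injective⇒length≤ : ∀ {R : X → Y → Set} {xs ys} → Unique xs →
  (∀ {x} → x ∈ xs → ∃[ y ] y ∈ ys × R x y) →
  (∀ {x x′ y} → x ∈ xs → x′ ∈ xs → R x y → R x′ y → x ≡ x′) → length xs ≤ length ys
injective⇒length≤ [] _ _ = z≤n
injective⇒length≤ {X} {Y} {R} {x ∷ xs} {ys} (x∉ ∷ xs!) f inj with f (here refl)
... | y , y∈ , r with ∈-∃++ y∈
...   | ys₁ , ys₂ , refl = subst (suc (length xs) ≤_) (sym len)
        (s≤s (injective⇒length≤ {R = R} {ys = ys₁ ++ ys₂} xs! f′ λ p q → inj (there p) (there q)))
  where
  len : length (ys₁ ++ y ∷ ys₂) ≡ suc (length (ys₁ ++ ys₂))
  len = trans (length-++ ys₁) (trans (+-suc (length ys₁) (length ys₂)) (cong suc (sym (length-++ ys₁))))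
  f′ : ∀ {x′} → x′ ∈ xs → ∃[ y′ ] y′ ∈ ys₁ ++ ys₂ × R x′ y′
  f′ x′∈ with f (there x′∈)
  ... | y′ , y′∈ , r′ with ∈-++⁻ ys₁ y′∈
  ...   | inj₁ p = y′ , ∈-++⁺ˡ p , r′
  ...   | inj₂ (here refl) = ⊥-elim (All.lookup x∉ x′∈ (inj (here refl) (there x′∈) r r′))
  ...   | inj₂ (there p) = y′ , ∈-++⁺ʳ ys₁ p , r′

-- A relation that is total and single-valued in both directions is enough, so no map between the
-- lists has to be defined. Membership of the partner is carried inside the relation because
-- single-valuedness is only asked of members of both lists.
correspondence⇒length≡ : ∀ {R : X → Y → Set} {xs ys} → Unique xs → Unique ys →
  (∀ {x} → x ∈ xs → ∃[ y ] y ∈ ys × R x y) →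
  (∀ {y} → y ∈ ys → ∃[ x ] x ∈ xs × R x y) →
  (∀ {x x′ y} → x ∈ xs → x′ ∈ xs → y ∈ ys → R x y → R x′ y → x ≡ x′) →
  (∀ {x y y′} → x ∈ xs → y ∈ ys → y′ ∈ ys → R x y → R x y′ → y ≡ y′) → length xs ≡ length ys
correspondence⇒length≡ {X} {Y} {R} {xs} {ys} xs! ys! f g left right = ≤-antisym
  (injective⇒length≤ {R = λ x y → y ∈ ys × R x y} xs!
    (λ x∈ → let y , y∈ , r = f x∈ in y , y∈ , y∈ , r) λ p q (y∈ , r) (_ , r′) → left p q y∈ r r′)
  (injective⇒length≤ {R = λ y x → x ∈ xs × R x y} ys!
    (λ y∈ → let x , x∈ , r = g y∈ in x , x∈ , x∈ , r) λ p q (x∈ , r) (_ , r′) → right x∈ p q r r′)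

-- Pigeonhole: if `v` were missing, `v ∷ w` would consist of `suc (length w)` distinct numbers below
-- `length w`.
unique-bounded⇒∈ : ∀ {w v} → Unique w → (∀ {x} → x ∈ w → x < length w) → v < length w → v ∈ w
unique-bounded⇒∈ {w} {v} w! bounded v< with any? (v ≟_) w
... | yes v∈ = v∈
... | no v∉ = ⊥-elim (<-irrefl refl (subst (suc (length w) ≤_) (length-upTo (length w))
        (injective⇒length≤ {R = _≡_} {xs = v ∷ w} {ys = upTo (length w)}
          (All.tabulate (λ { x∈ refl → v∉ x∈ }) ∷ w!)
          (λ x∈ → _ , ∈-upTo⁺ (bounded′ x∈) , refl) λ { _ _ refl refl → refl })))
  where
  bounded′ : ∀ {x} → x ∈ v ∷ w → x < length w
  bounded′ (here refl) = v<
  bounded′ (there x∈) = bounded x∈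

firstIndex : List ℕ → ℕ → ℕ
firstIndex [] v = 0
firstIndex (x ∷ w) v with x ≟ v
... | yes _ = 0
... | no  _ = suc (firstIndex w v)

firstIndex-∈ : ∀ {w v} → v ∈ w → firstIndex w v < length w × at w (firstIndex w v) ≡ v
firstIndex-∈ {x ∷ w} {v} v∈ with x ≟ v | v∈
... | yes e | _ = s≤s z≤n , e
... | no x≢v | here e = ⊥-elim (x≢v (sym e))
... | no _ | there v∈′ = let a , b = firstIndex-∈ v∈′ in s≤s a , b

unique⇒bijection : ∀ {w} → Unique w → (∀ {x} → x ∈ w → x < length w) → IsBijection (length w) (at w)
unique⇒bijection {w} w! bounded = record
  { f<n = bounded ∘ at-∈ w
  ; inj = λ {i} {j} i< j< e → inj i< j< e
  ; pos = firstIndex w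
  ; pos<n = λ v< → proj₁ (firstIndex-∈ (unique-bounded⇒∈ w! bounded v<))
  ; f-pos = λ v< → proj₂ (firstIndex-∈ (unique-bounded⇒∈ w! bounded v<))
  }
  where
  inj : ∀ {i j} → i < length w → j < length w → at w i ≡ at w j → i ≡ j
  inj {i} {j} i< j< e with <-cmp i j
  ... | tri< p _ _ = ⊥-elim (AllPairs-at⁻ w! p j< e)
  ... | tri≈ _ p _ = p
  ... | tri> _ _ p = ⊥-elim (AllPairs-at⁻ w! p i< (sym e))

∈-perms⁻ : ∀ {n w} → w ∈ perms n → length w ≡ n × Unique w × (∀ {x} → x ∈ w → x < length w)
∈-perms⁻ {n} {w} w∈ with ∈-filterᵇ⁻ {p = isPerm n} w∈
... | w∈words , isP with ∈-words⁻ n w∈words | to (T-∧ {length w ≡ᵇ n}) isP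
...   | refl , bounded | _ , isP′ with to (T-∧ {all (_<ᵇ n) w}) isP′
...     | _ , distinct = refl , AllPairs-at⁺ w (λ i<j j< e → ≢-at i<j j< e) , bounded
  where
  ≢-at : ∀ {i j} → i < j → j < length w → at w i ≢ at w j
  ≢-at {i} {j} i<j j< e with to (T-∨ {i ≡ᵇ j}) (all-upTo⁻ (all-upTo⁻ {n} distinct {i} (<-trans i<j j<)) {j} j<)
  ... | inj₁ i≡j = <-irrefl (≡ᵇ⇒≡ i j i≡j) i<j
  ... | inj₂ ne = T-not⁻ ne (≡⇒≡ᵇ _ _ e)

∈-perms⁺ : ∀ {w} → Unique w → (∀ {x} → x ∈ w → x < length w) → w ∈ perms (length w)
∈-perms⁺ {w} w! bounded = ∈-filterᵇ⁺ {p = isPerm n} (∈-words⁺ n refl bounded)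
  (from (T-∧ {n ≡ᵇ n}) (≡⇒≡ᵇ n n refl , from (T-∧ {all (_<ᵇ n) w})
    (all⁻ (_<ᵇ n) (All.tabulate (<⇒<ᵇ ∘ bounded)) , all-upTo⁺ λ i< → all-upTo⁺ λ j< → distinct i< j<)))
  where
  n = length w
  distinct : ∀ {i j} → i < n → j < n → T ((i ≡ᵇ j) ∨ not (at w i ≡ᵇ at w j))
  distinct {i} {j} i< j< with at w i ≟ at w j
  ... | yes e = from (T-∨ {i ≡ᵇ j}) (inj₁ (≡⇒≡ᵇ i j (IsBijection.inj (unique⇒bijection w! bounded) i< j< e)))
  ... | no ne = from (T-∨ {i ≡ᵇ j}) (inj₂ (T-not⁺ (ne ∘ ≡ᵇ⇒≡ _ _)))

-- Occurrences of the pattern and positions in rotations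

record Occurrence (w : List ℕ) : Set where
  constructor occurrence
  field
    i j k : ℕ
    i<j : suc i < j
    j<k : j < k
    k<n : k < length w
    z<x : at w j < at w i
    x<y : at w i < at w (suc i)
    y<w : at w (suc i) < at w k

contains⁺ : ∀ {w} → Occurrence w → T (contains-23-14 w)
contains⁺ {w} (occurrence i j k i<j j<k k<n z<x x<y y<w) =
  any-upTo⁺ (<-trans (m+n≤o⇒n≤o 1 i<j) j<n) (any-upTo⁺ j<n (any-upTo⁺ k<n
    (from T-∧ (<⇒<ᵇ i<j , from T-∧ (<⇒<ᵇ j<k , from T-∧ (<⇒<ᵇ z<x , from T-∧ (<⇒<ᵇ x<y , <⇒<ᵇ y<w)))))))
  where j<n = <-trans j<k k<n

contains⁻ : ∀ {w} → T (contains-23-14 w) → Occurrence w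
contains⁻ {w} h with any-upTo⁻ {length w} h
... | i , i<n , h₁ with any-upTo⁻ {length w} h₁
...   | j , j<n , h₂ with any-upTo⁻ {length w} h₂
...     | k , k<n , h₃ =
  let a , r₁ = to (T-∧ {suc i <ᵇ j}) h₃
      b , r₂ = to (T-∧ {j <ᵇ k}) r₁
      c , r₃ = to (T-∧ {at w j <ᵇ at w i}) r₂
      d , e  = to (T-∧ {at w i <ᵇ at w (suc i)}) r₃
  in occurrence i j k (<ᵇ⇒< _ _ a) (<ᵇ⇒< _ _ b) k<n (<ᵇ⇒< _ _ c) (<ᵇ⇒< _ _ d) (<ᵇ⇒< _ _ e)

cyc-contains⁺ : ∀ {w k} → k < length w → Occurrence (rotate k w) → T (cyc-contains-23-14 w)
cyc-contains⁺ {w} {k} k< occ = any⁺ contains-23-14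
  (lose (∈-map⁺ (λ k → rotate k w) (∈-upTo⁺ k<)) (contains⁺ occ))

cyc-contains⁻ : ∀ {w} → T (cyc-contains-23-14 w) → ∃[ k ] k < length w × Occurrence (rotate k w)
cyc-contains⁻ {w} h with find (any⁻ contains-23-14 (rotations w) h)
... | _ , v∈ , c with ∈-map⁻ (λ k → rotate k w) v∈
...   | k , k∈ , refl = k , ∈-upTo⁻ k∈ , contains⁻ c

at-++ˡ : ∀ u v {i} → i < length u → at (u ++ v) i ≡ at u i
at-++ˡ (x ∷ u) v {zero} _ = refl
at-++ˡ (x ∷ u) v {suc i} (s≤s i<) = at-++ˡ u v i<

at-++ʳ : ∀ u v i → at (u ++ v) (length u + i) ≡ at v i
at-++ʳ [] v i = refl
at-++ʳ (x ∷ u) v i = at-++ʳ u v i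

at-drop : ∀ k w i → at (drop k w) i ≡ at w (k + i)
at-drop zero w i = refl
at-drop (suc k) [] i = refl
at-drop (suc k) (x ∷ w) i = at-drop k w i

at-take : ∀ k w {i} → i < k → at (take k w) i ≡ at w i
at-take (suc k) [] _ = refl
at-take (suc k) (x ∷ w) {zero} _ = refl
at-take (suc k) (x ∷ w) {suc i} (s≤s i<k) = at-take k w i<k

module _ {w : List ℕ} (k r : ℕ) (k+r≡n : k + r ≡ length w) where

  private
    length-drop≡r : length (drop k w) ≡ r
    length-drop≡r = trans (length-drop k w) (trans (cong (_∸ k) (sym k+r≡n)) (m+n∸m≡n k r))

  at-rotateˡ : ∀ {i} → i < r → at (rotate k w) i ≡ at w (k + i)
  at-rotateˡ {i} i<r = trans (at-++ˡ (drop k w) (take k w) (subst (i <_) (sym length-drop≡r) i<r)) (at-drop k w i)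

  at-rotateʳ : ∀ {i} → i < k → at (rotate k w) (r + i) ≡ at w i
  at-rotateʳ {i} i<k = trans (cong (λ r → at (rotate k w) (r + i)) (sym length-drop≡r))
    (trans (at-++ʳ (drop k w) (take k w) i) (at-take k w i<k))

  length-rotate : length (rotate k w) ≡ k + r
  length-rotate = trans (length-++ (drop k w)) (trans (cong₂ _+_ length-drop≡r
    (trans (length-take k w) (m≤n⇒m⊓n≡m (≤-trans (m≤m+n k r) (≤-reflexive k+r≡n))))) (+-comm r k))

-- Cyclic avoidance against the two linear conditions

¬cyc-contains⇒good : ∀ {w} → IsBijection (length w) (at w) → at w 0 ≡ 0 →
                     ¬ T (cyc-contains-23-14 w) → Good (length w) (at w)
¬cyc-contains⇒good {w} bij w0≡0 avoids = record
  { starts-at-0 = w0≡0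
  ; no-23-1-4 = λ {i} {j} {k} i<j j<k k<n z<x x<y y<w →
      let j<n = <-trans j<k k<n ; si<n = <-trans i<j j<n ; i<n = m+n≤o⇒n≤o 1 si<n
          -- Rotation by 0 is `w ++ []`, so the entries still have to be transported.
          eq = λ {p} (p<n : p < length w) → sym (at-rotateˡ {w} 0 (length w) refl p<n)
      in avoids (cyc-contains⁺ {w} {0} (≤-<-trans z≤n k<n) (occurrence i j k i<j j<k
           (subst (k <_) (sym (length-rotate {w} 0 (length w) refl)) k<n)
           (subst₂ _<_ (eq j<n) (eq i<n) z<x) (subst₂ _<_ (eq i<n) (eq si<n) x<y)
           (subst₂ _<_ (eq si<n) (eq k<n) y<w)))
  ; no-4-23 = wrap
  }
  where
  open IsBijection bij
  -- Rotating the ascent to the front, the 0 that starts w plays the role of the letter 1 of the pattern.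
  wrap : ∀ {a i} → a < i → suc i < length w → at w i < at w (suc i) → ¬ at w (suc i) < at w a
  wrap {a} {i} a<i si<n x<y y<w = avoids (cyc-contains⁺ {w} {i} i<n (occurrence 0 (r + 0) (r + a)
      (<-≤-trans 1<r (m≤m+n r 0)) (+-monoʳ-< r 0<a)
      (subst (r + a <_) (sym (length-rotate {w} i r e)) (<-≤-trans (+-monoʳ-< r a<i) (≤-reflexive (+-comm r i))))
      (subst₂ _<_ (sym (trans (at-rotateʳ {w} i r e 0<i) w0≡0)) (sym at0) 0<wi)
      (subst₂ _<_ (sym at0) (sym at1) x<y)
      (subst₂ _<_ (sym at1) (sym (at-rotateʳ {w} i r e a<i)) y<w)))
    where
    i<n = m+n≤o⇒n≤o 1 si<n
    r = length w ∸ i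
    e = m+[n∸m]≡n (<⇒≤ i<n)
    0<i = ≤-<-trans z≤n a<i
    1<r : 1 < r
    1<r = +-cancelˡ-< i 1 r (subst₂ _<_ (+-comm 1 i) (sym e) si<n)
    at0 = trans (at-rotateˡ {w} i r e (<-trans z<s 1<r)) (cong (at w) (+-identityʳ i))
    at1 = trans (at-rotateˡ {w} i r e 1<r) (cong (at w) (+-comm i 1))
    0<wi : 0 < at w i
    0<wi = n≢0⇒n>0 λ wi≡0 → <-irrefl (inj (<-trans 0<i i<n) i<n (trans w0≡0 (sym wi≡0))) 0<i
    0<a : 0 < a
    0<a = n≢0⇒n>0 λ { refl → n≮0 (subst (at w (suc i) <_) w0≡0 y<w) }

-- Position `r` is the seam of the rotation by `s`, where `w` starts anew. An occurrence entirely on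
-- one side of the seam is a linear 23-1-4 of `w`. If the ascent lies before the seam and the 4
-- beyond it, the 4 precedes the ascent in `w` and they form a 4-23, whichever side the 1 is on.
good⇒¬cyc-contains : ∀ {w} → Good (length w) (at w) → ¬ T (cyc-contains-23-14 w)
good⇒¬cyc-contains {w} good c with cyc-contains⁻ {w} c
... | s , s<n , occurrence i j k i<j j<k k<len z<x x<y y<w = impossible
  where
  open Good good
  r = length w ∸ s
  v = rotate s w

  s+r≡n : s + r ≡ length w
  s+r≡n = m+[n∸m]≡n (<⇒≤ s<n)

  k<s+r : k < s + r
  k<s+r = subst (k <_) (length-rotate {w} s r s+r≡n) k<len

  at-low : ∀ {p} → p < r → at v p ≡ at w (s + p)
  at-low = at-rotateˡ {w} s r s+r≡n

  high<s : ∀ {q} → r + q ≤ k → q < s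
  high<s {q} q≤ = +-cancelˡ-< r q s (<-≤-trans (≤-<-trans q≤ k<s+r) (≤-reflexive (+-comm s r)))

  at-high : ∀ {q} → r + q ≤ k → at v (r + q) ≡ at w q
  at-high q≤ = at-rotateʳ {w} s r s+r≡n (high<s q≤)

  si<k : suc i < k
  si<k = <-trans i<j j<k

  locate : ∀ p → p < r ⊎ ∃[ q ] r + q ≡ p
  locate p with p <? r
  ... | yes p<r = inj₁ p<r
  ... | no p≮r = inj₂ (p ∸ r , m+[n∸m]≡n (≮⇒≥ p≮r))

  shift : ∀ {p q} → p < q → s + p < s + q
  shift = +-monoʳ-< s

  impossible : ⊥
  impossible with locate (suc i)
  -- An ascent top at the seam would be the initial 0 of `w`, which has nothing below it.
  ... | inj₂ (zero , e) = n≮0 (subst (at v i <_)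
          (trans (cong (at v) (sym e)) (trans (at-high (≤-trans (≤-reflexive e) (<⇒≤ si<k))) starts-at-0)) x<y)
  ... | inj₁ si<r with locate k
  ...   | inj₁ k<r = no-23-1-4 (subst (_< s + j) (+-suc s i) (shift i<j)) (shift j<k)
            (<-≤-trans (shift k<r) (≤-reflexive s+r≡n))
            (subst₂ _<_ (at-low (<-trans j<k k<r)) at-i z<x) (subst₂ _<_ at-i at-si x<y)
            (subst₂ _<_ at-si (at-low k<r) y<w)
    where
    at-i  = at-low (m+n≤o⇒n≤o 1 si<r)
    at-si = trans (at-low si<r) (cong (at w) (+-suc s i))
  ...   | inj₂ (q , e) = no-4-23 (<-≤-trans (high<s (≤-reflexive e)) (m≤m+n s i))
            (subst₂ _<_ (+-suc s i) s+r≡n (shift si<r)) (subst₂ _<_ at-i at-si x<y)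
            (subst₂ _<_ at-si (trans (cong (at v) (sym e)) (at-high (≤-reflexive e))) y<w)
    where
    at-i  = at-low (m+n≤o⇒n≤o 1 si<r)
    at-si = trans (at-low si<r) (cong (at w) (+-suc s i))
  -- The ascent lies entirely beyond the seam, hence so do the 1 and the 4; all positions drop by
  -- `r`.
  impossible | inj₂ (suc q , e) with suc-injective (trans (sym (+-suc r q)) e) | locate j | locate k
  ... | _    | inj₁ j<r | _ = <-irrefl refl (<-trans j<r (≤-<-trans (m≤m+n r (suc q)) (subst (_< j) (sym e) i<j)))
  ... | _    | _ | inj₁ k<r = <-irrefl refl (<-trans k<r (≤-<-trans (m≤m+n r (suc q)) (subst (_< k) (sym e) si<k)))
  ... | refl | inj₂ (qj , refl) | inj₂ (qk , refl) = no-23-1-4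
          (+-cancelˡ-< r _ _ (subst (_< j) (sym (+-suc r q)) i<j)) (+-cancelˡ-< r qj qk j<k)
          (<-trans (high<s ≤-refl) s<n)
          (subst₂ _<_ (at-high (<⇒≤ j<k)) at-i z<x) (subst₂ _<_ at-i at-si x<y)
          (subst₂ _<_ at-si (at-high ≤-refl) y<w)
    where
    i<k = m+n≤o⇒n≤o 1 si<k
    at-i = at-high (<⇒≤ i<k)
    at-si = trans (cong (at v) (sym (+-suc r q))) (at-high (≤-trans (≤-reflexive (+-suc r q)) (<⇒≤ si<k)))

-- Its length is `numAvCyc-23-14 n` by definition.
avoiders : ℕ → List (List ℕ)
avoiders n = filterᵇ (λ w → isCycRep w ∧ not (cyc-contains-23-14 w)) (perms n)

avoiders-unique : ∀ n → Unique (avoiders n)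
avoiders-unique n = filterᵇ-unique _ (filterᵇ-unique (isPerm n) (words-unique n))

isCycRep⁻ : ∀ w → T (isCycRep w) → at w 0 ≡ 0
isCycRep⁻ (x ∷ w) = ≡ᵇ⇒≡ x 0

isCycRep⁺ : ∀ w → 0 < length w → at w 0 ≡ 0 → T (isCycRep w)
isCycRep⁺ (x ∷ w) _ = ≡⇒≡ᵇ x 0

∈-avoiders⁻ : ∀ {n w} → w ∈ avoiders n →
              length w ≡ n × Unique w × (∀ {x} → x ∈ w → x < length w) × Good (length w) (at w)
∈-avoiders⁻ {n} {w} w∈ with ∈-filterᵇ⁻ w∈
... | w∈perms , p =
  let len , w! , bounded = ∈-perms⁻ w∈perms
      rep , avoids = to (T-∧ {isCycRep w}) p
  in len , w! , bounded
     , ¬cyc-contains⇒good {w} (unique⇒bijection w! bounded) (isCycRep⁻ w rep) (T-not⁻ avoids)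

∈-avoiders⁺ : ∀ {w} → 0 < length w → Unique w → (∀ {x} → x ∈ w → x < length w) →
              Good (length w) (at w) → w ∈ avoiders (length w)
∈-avoiders⁺ {w} 0< w! bounded good = ∈-filterᵇ⁺ (∈-perms⁺ w! bounded)
  (from (T-∧ {isCycRep w}) (isCycRep⁺ w 0< (Good.starts-at-0 good) , T-not⁺ (good⇒¬cyc-contains {w} good)))

-- Strongly monotone partitions as words of block labels

data _[_]↦_ {X : Set} : List X → ℕ → X → Set where
  here  : ∀ {x xs} → (x ∷ xs) [ 0 ]↦ x
  there : ∀ {x y xs i} → xs [ i ]↦ y → (x ∷ xs) [ suc i ]↦ y

↦⇒< : ∀ {xs : List X} {i x} → xs [ i ]↦ x → i < length xs
↦⇒< here = z<s
↦⇒< (there p) = s<s (↦⇒< p)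

↦⇒at : ∀ {w i x} → w [ i ]↦ x → at w i ≡ x
↦⇒at here = refl
↦⇒at (there p) = ↦⇒at p

at⇒↦ : ∀ {w i x} → i < length w → at w i ≡ x → w [ i ]↦ x
at⇒↦ {x ∷ w} {zero} _ refl = here
at⇒↦ {x ∷ w} {suc i} (s≤s i<) e = there (at⇒↦ i< e)

↦⇒∈ : ∀ {xs : List X} {i x} → xs [ i ]↦ x → x ∈ xs
↦⇒∈ here = here refl
↦⇒∈ (there p) = there (↦⇒∈ p)

∈⇒↦ : ∀ {xs : List X} {x} → x ∈ xs → ∃[ i ] xs [ i ]↦ x
∈⇒↦ (here refl) = 0 , here
∈⇒↦ (there p) = let i , q = ∈⇒↦ p in suc i , there q

-- P t b says that t lies in block b.
record StronglyMonotone (P : ℕ → ℕ → Set) : Set where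
  field
    minima : ∀ {t b} → P t (suc b) → ∃[ s ] s < t × P s b
    maxima : ∀ {t t′ a} → P t a → P t′ (suc a) → ∃[ u ] t < u × P u (suc a)

  smaller-used : ∀ {t b} a → P t a → b ≤ a → ∃[ s ] s ≤ t × P s b
  smaller-used {t} zero p z≤n = t , ≤-refl , p
  smaller-used {t} (suc a) p b≤a with m≤n⇒m<n∨m≡n b≤a
  ... | inj₂ refl = t , ≤-refl , p
  ... | inj₁ (s≤s b≤a′) =
        let s , s<t , q = minima p
            u , u≤s , r = smaller-used a q b≤a′
        in u , ≤-trans u≤s (<⇒≤ s<t) , r

  -- Descending through the smaller labels strictly decreases the position. This puts every strongly
  -- monotone word into the finite list that `A` filters.
  label≤index : ∀ {t} b → P t b → b ≤ t
  label≤index zero _ = z≤n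
  label≤index (suc b) p = let s , s<t , q = minima p in ≤-trans (s≤s (label≤index b q)) s<t

maxL-upper : ∀ {w x} → x ∈ w → x ≤ maxL w
maxL-upper {y ∷ w} (here refl) = m≤m⊔n y (maxL w)
maxL-upper {y ∷ w} (there x∈) = ≤-trans (maxL-upper x∈) (m≤n⊔m y (maxL w))

maxL-take-attained : ∀ x w t → ∃[ s ] s < suc t × s < suc (length w) × maxL (take (suc t) (x ∷ w)) ≡ at (x ∷ w) s
maxL-take-attained x w zero = 0 , z<s , z<s , ⊔-identityʳ x
maxL-take-attained x [] (suc t) = 0 , z<s , z<s , ⊔-identityʳ x
maxL-take-attained x (y ∷ w) (suc t) with ⊔-sel x (maxL (take (suc t) (y ∷ w)))
... | inj₁ e = 0 , z<s , z<s , e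
... | inj₂ e = let s , s<t , s< , e′ = maxL-take-attained y w t in suc s , s<s s<t , s<s s< , trans e e′

at≤maxL-take : ∀ w {s t} → s < t → s < length w → at w s ≤ maxL (take t w)
at≤maxL-take (x ∷ w) {zero} {suc t} _ _ = m≤m⊔n x _
at≤maxL-take (x ∷ w) {suc s} {suc t} (s≤s s<t) (s≤s s<) = ≤-trans (at≤maxL-take w s<t s<) (m≤n⊔m x _)

maxL-attained : ∀ x w → maxL (x ∷ w) ∈ x ∷ w
maxL-attained x [] = here (⊔-identityʳ x)
maxL-attained x (y ∷ w) with ⊔-sel x (maxL (y ∷ w))
... | inj₁ e = here e
... | inj₂ e = there (subst (_∈ y ∷ w) (sym e) (maxL-attained y w))

∈⇒<nBlocks : ∀ {w b} → b ∈ w → b < nBlocks w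
∈⇒<nBlocks {x ∷ w} b∈ = s≤s (maxL-upper b∈)

nBlocks-attained : ∀ w {k} → nBlocks w ≡ suc k → k ∈ w
nBlocks-attained (x ∷ w) refl = maxL-attained x w

-- The prefix maximum that bounds an entry is itself an earlier entry, and is at least `b`; if it is
-- larger, the argument repeats from there. For this recursion `go` assumes `suc b ≤ at w t` instead
-- of equality.
rgs⇒minima : ∀ {w} → T (isRGS w) → ∀ {t b} → w [ t ]↦ suc b → ∃[ s ] s < t × w [ s ]↦ b
rgs⇒minima {[]} _ ()
rgs⇒minima {w@(x ∷ w′)} rgs {t} p = go t (<-wellFounded t) (↦⇒< p) (≤-reflexive (sym (↦⇒at p)))
  where
  go : ∀ {b} t → Acc _<_ t → t < length w → suc b ≤ at w t → ∃[ s ] s < t × w [ s ]↦ b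
  go zero _ t< b<at with () ← n≮0 (≤-trans b<at (≤ᵇ⇒≤ x 0 (all-upTo⁻ rgs {0} t<)))
  go {b} (suc t) (acc rec) t< b<at with maxL-take-attained x w′ t
  ... | s , s<t , s< , e
        with m≤n⇒m<n∨m≡n (subst (b ≤_) e (≤-pred (≤-trans b<at (≤ᵇ⇒≤ _ _ (all-upTo⁻ rgs {suc t} t<)))))
  ...   | inj₂ b≡ = s , s<t , at⇒↦ s< (sym b≡)
  ...   | inj₁ b< = let u , u<s , q = go s (rec s<t) s< b< in u , <-trans u<s s<t , q

minima⇒rgs : ∀ {w} → (∀ {t b} → w [ t ]↦ suc b → ∃[ s ] s < t × w [ s ]↦ b) → T (isRGS w)
minima⇒rgs {w} minima = all-upTo⁺ {length w} λ
  { {zero} t< → ≤⇒≤ᵇ (first t<) ; {suc t} t< → ≤⇒≤ᵇ (later t t<) }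
  where
  first : 0 < length w → at w 0 ≤ 0
  first 0< with at w 0 in e
  ... | zero = z≤n
  ... | suc b = ⊥-elim (n≮0 (proj₁ (proj₂ (minima (at⇒↦ 0< e)))))
  later : ∀ t → suc t < length w → at w (suc t) ≤ suc (maxL (take (suc t) w))
  later t t< with at w (suc t) in e
  ... | zero = z≤n
  ... | suc b = let s , s<t , p = minima (at⇒↦ t< e)
                in s≤s (subst (_≤ maxL (take (suc t) w)) (↦⇒at p) (at≤maxL-take w s<t (↦⇒< p)))

-- lastPosGo names the local recursion in the definition of lastPos, which is not in scope here;
-- its body is inferred from the second definition.
mutual
  lastPosGo : List ℕ → ℕ → List ℕ → ℕ
  lastPosGo = _

  lastPos-unfold : ∀ w b → lastPos w b ≡ lastPosGo w b (upTo (length w))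
  lastPos-unfold w b with upTo (length w)
  ... | ts = refl {x = lastPosGo w b ts}

module _ (w : List ℕ) (b : ℕ) where

  lastPosGo-upper : ∀ {t ts} → t ∈ ts → at w t ≡ b → t ≤ lastPosGo w b ts
  lastPosGo-upper {t} {s ∷ ts} t∈ e with at w s ≡ᵇ b in eq | t∈
  ... | true | here refl = m≤m⊔n s _
  ... | true | there t∈′ = ≤-trans (lastPosGo-upper t∈′ e) (m≤n⊔m s _)
  ... | false | here refl = ⊥-elim (subst T eq (≡⇒≡ᵇ _ _ e))
  ... | false | there t∈′ = lastPosGo-upper t∈′ e

  -- The second alternative isolates the default value 0, which results for a label that does not
  -- occur.
  lastPosGo-attained : ∀ ts → (lastPosGo w b ts ∈ ts × at w (lastPosGo w b ts) ≡ b)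
                            ⊎ (lastPosGo w b ts ≡ 0 × ∀ {t} → t ∈ ts → at w t ≢ b)
  lastPosGo-attained [] = inj₂ (refl , λ ())
  lastPosGo-attained (s ∷ ts) with at w s ≡ᵇ b in eq | lastPosGo-attained ts
  ... | false | inj₁ (l∈ , e) = inj₁ (there l∈ , e)
  ... | false | inj₂ (e₀ , none) =
        inj₂ (e₀ , λ { (here refl) e → subst T eq (≡⇒≡ᵇ _ _ e) ; (there t∈) → none t∈ })
  ... | true | r with ⊔-sel s (lastPosGo w b ts) | ≡ᵇ⇒≡ (at w s) b (subst T (sym eq) _) | r
  ...   | inj₁ e | at≡b | _ = inj₁ (here e , trans (cong (at w) e) at≡b)
  ...   | inj₂ e | at≡b | inj₁ (l∈ , e′) =
          inj₁ (subst (_∈ s ∷ ts) (sym e) (there l∈) , trans (cong (at w) e) e′)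
  -- No position in the rest of the list carries the label, and the default 0 is absorbed by the
  -- maximum with `s`.
  ...   | inj₂ _ | at≡b | inj₂ (e₀ , _) =
          let e = trans (cong (s ⊔_) e₀) (⊔-identityʳ s) in inj₁ (here e , trans (cong (at w) e) at≡b)

  ≤lastPos : ∀ {t} → w [ t ]↦ b → t ≤ lastPos w b
  ≤lastPos p = subst (_ ≤_) (sym (lastPos-unfold w b)) (lastPosGo-upper (∈-upTo⁺ (↦⇒< p)) (↦⇒at p))

  lastPos-attained : ∀ {t} → w [ t ]↦ b → w [ lastPos w b ]↦ b
  lastPos-attained p with lastPosGo-attained (upTo (length w))
  ... | inj₂ (_ , none) = ⊥-elim (none (∈-upTo⁺ (↦⇒< p)) (↦⇒at p))
  ... | inj₁ (l∈ , e) = subst (λ l → w [ l ]↦ b) (sym (lastPos-unfold w b)) (at⇒↦ (∈-upTo⁻ l∈) e)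

sm⇒stronglyMonotone : ∀ {w} → T (isRGS w ∧ isStronglyMonotone w) → StronglyMonotone (w [_]↦_)
sm⇒stronglyMonotone {w} h = record
  { minima = rgs⇒minima rgs
  ; maxima = λ {t} {t′} {a} p q →
      -- The last occurrence of the next label comes after that of `a`, hence after `t`.
      lastPos w (suc a)
      , ≤-<-trans (≤lastPos w a p) (lastPos-< (∈⇒<nBlocks (↦⇒∈ q)))
      , lastPos-attained w (suc a) q
  }
  where
  rgs = proj₁ (to (T-∧ {isRGS w}) h)
  lastPos-< : ∀ {a} → suc a < nBlocks w → lastPos w a < lastPos w (suc a)
  lastPos-< {a} sa<
    with to (T-∨ {not (a <ᵇ suc a)})
            (all-upTo⁻ (all-upTo⁻ {nBlocks w} (proj₂ (to (T-∧ {isRGS w}) h)) {a} (m+n≤o⇒n≤o 1 sa<)) {suc a} sa<)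
  ... | inj₁ a≮sa = ⊥-elim (T-not⁻ {a <ᵇ suc a} a≮sa (<⇒<ᵇ (n<1+n a)))
  ... | inj₂ lt = <ᵇ⇒< _ _ lt

-- The largest label occurs because `nBlocks` is computed from the maximum, and `smaller-used`
-- descends from it, so labels have no gaps.
stronglyMonotone-used : ∀ {w b} → StronglyMonotone (w [_]↦_) → b < nBlocks w → ∃[ t ] w [ t ]↦ b
stronglyMonotone-used {w} {b} sm b< with nBlocks w in e
... | suc k = let t , p = ∈⇒↦ (nBlocks-attained w e)
                  s , _ , q = StronglyMonotone.smaller-used sm k p (≤-pred b<)
              in s , q

stronglyMonotone⇒sm : ∀ {w} → StronglyMonotone (w [_]↦_) → T (isRGS w ∧ isStronglyMonotone w)
stronglyMonotone⇒sm {w} sm = from (T-∧ {isRGS w}) (minima⇒rgs minima ,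
  all-upTo⁺ {nBlocks w} λ {a} a< → all-upTo⁺ {nBlocks w} λ {b} b< → ordered a b b<)
  where
  open StronglyMonotone sm
  step : ∀ {a} → suc a < nBlocks w → lastPos w a < lastPos w (suc a)
  step {a} sa< with stronglyMonotone-used sm (m+n≤o⇒n≤o 1 sa<) | stronglyMonotone-used sm sa<
  -- `maxima` applied to the last `a` gives an occurrence of `suc a` beyond it.
  ... | _ , p | _ , q = let u , l<u , r = maxima (lastPos-attained w a p) q
                        in <-≤-trans l<u (≤lastPos w (suc a) r)
  lastPos-< : ∀ {a b} → a <′ b → b < nBlocks w → lastPos w a < lastPos w b
  lastPos-< (≤′-reflexive refl) b< = step b<
  lastPos-< (≤′-step a<b) b< = <-trans (lastPos-< a<b (m+n≤o⇒n≤o 1 b<)) (step b<)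
  ordered : ∀ a b → b < nBlocks w → T (not (a <ᵇ b) ∨ (lastPos w a <ᵇ lastPos w b))
  ordered a b b< with a <? b
  ... | yes a<b = from (T-∨ {not (a <ᵇ b)}) (inj₂ (<⇒<ᵇ (lastPos-< (<⇒<′ a<b) b<)))
  ... | no a≮b = from (T-∨ {not (a <ᵇ b)}) (inj₁ (T-not⁺ (a≮b ∘ <ᵇ⇒< a b)))

-- Codes: label words interspersed with unlabelled entries

rank : List (Maybe X) → ℕ → ℕ
rank [] t = 0
rank (c ∷ cs) zero = 0
rank (just _ ∷ cs) (suc t) = suc (rank cs t)
rank (nothing ∷ cs) (suc t) = rank cs t

-- `rank c t` counts the `just` entries before position `t`, so it is the place of entry `t` once
-- the `nothing` entries are deleted.
↦-catMaybes⁺ : ∀ {c : List (Maybe X)} {t a} → c [ t ]↦ just a → catMaybes c [ rank c t ]↦ a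
↦-catMaybes⁺ here = here
↦-catMaybes⁺ {c = just _ ∷ c} (there p) = there (↦-catMaybes⁺ p)
↦-catMaybes⁺ {c = nothing ∷ c} (there p) = ↦-catMaybes⁺ p

↦-catMaybes⁻ : ∀ (c : List (Maybe X)) {s a} → catMaybes c [ s ]↦ a → ∃[ t ] c [ t ]↦ just a × rank c t ≡ s
↦-catMaybes⁻ (just _ ∷ c) here = 0 , here , refl
↦-catMaybes⁻ (just _ ∷ c) (there p) = let t , q , e = ↦-catMaybes⁻ c p in suc t , there q , cong suc e
↦-catMaybes⁻ (nothing ∷ c) p = let t , q , e = ↦-catMaybes⁻ c p in suc t , there q , e

rank-mono : ∀ (c : List (Maybe X)) {t t′} → t ≤ t′ → rank c t ≤ rank c t′
rank-mono [] _ = z≤n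
rank-mono (x ∷ c) z≤n = z≤n
rank-mono (just _ ∷ c) (s≤s h) = s≤s (rank-mono c h)
rank-mono (nothing ∷ c) (s≤s h) = rank-mono c h

rank-strict : ∀ {c : List (Maybe X)} {t t′ a} → c [ t ]↦ just a → t < t′ → rank c t < rank c t′
rank-strict {c = just _ ∷ c} here (s≤s h) = z<s
rank-strict {c = just _ ∷ c} (there p) (s≤s h) = s<s (rank-strict p h)
rank-strict {c = nothing ∷ c} (there p) (s≤s h) = rank-strict p h

rank-reflects-< : ∀ (c : List (Maybe X)) {t t′} → rank c t < rank c t′ → t < t′
rank-reflects-< c lt = ≰⇒> λ t′≤t → <⇒≱ lt (rank-mono c t′≤t)

Positions : List (Maybe ℕ) → ℕ → ℕ → Set
Positions c t b = c [ t ]↦ just b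

-- Strong monotonicity depends only on the relative order of positions, and `rank` preserves and
-- reflects this order on the entries that are kept.
catMaybes⇒positions : ∀ {c} → StronglyMonotone (catMaybes c [_]↦_) → StronglyMonotone (Positions c)
catMaybes⇒positions {c} sm = record
  { minima = λ p → lift< (minima (↦-catMaybes⁺ p))
  ; maxima = λ p q → lift> (maxima (↦-catMaybes⁺ p) (↦-catMaybes⁺ q))
  }
  where
  open StronglyMonotone sm
  lift< : ∀ {t b} → ∃[ s ] s < rank c t × catMaybes c [ s ]↦ b → ∃[ s ] s < t × Positions c s b
  lift< (_ , lt , p) with ↦-catMaybes⁻ c p
  ... | s , q , refl = s , rank-reflects-< c lt , q
  lift> : ∀ {t b} → ∃[ s ] rank c t < s × catMaybes c [ s ]↦ b → ∃[ s ] t < s × Positions c s b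
  lift> (_ , lt , p) with ↦-catMaybes⁻ c p
  ... | s , q , refl = s , rank-reflects-< c lt , q

positions⇒catMaybes : ∀ {c} → StronglyMonotone (Positions c) → StronglyMonotone (catMaybes c [_]↦_)
positions⇒catMaybes {c} sm = record { minima = min ; maxima = max }
  where
  open StronglyMonotone sm
  min : ∀ {s b} → catMaybes c [ s ]↦ suc b → ∃[ r ] r < s × catMaybes c [ r ]↦ b
  min p with ↦-catMaybes⁻ c p
  ... | t , q , refl = let u , u<t , r = minima q in rank c u , rank-strict r u<t , ↦-catMaybes⁺ r
  max : ∀ {s s′ a} → catMaybes c [ s ]↦ a → catMaybes c [ s′ ]↦ suc a →
        ∃[ r ] s < r × catMaybes c [ r ]↦ suc a
  max p p′ with ↦-catMaybes⁻ c p | ↦-catMaybes⁻ c p′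
  ... | t , q , refl | _ , q′ , _ =
        let u , t<u , r = maxima q q′ in rank c u , rank-strict q t<u , ↦-catMaybes⁺ r

-- From a code to a labelled partition

blockLabel : ℕ → List (Maybe ℕ) → ℕ → ℕ
blockLabel K [] t = K
blockLabel K (x ∷ c) zero = maybe′ suc K x
blockLabel K (x ∷ c) (suc t) = blockLabel K c t

-- Labels 1 to `nBlocks (catMaybes c)` go to the blocks of the code, so the last block gets the next
-- one.
topLabel : List (Maybe ℕ) → ℕ
topLabel c = suc (nBlocks (catMaybes c))

-- Entry `t` of the code belongs to the value `suc t`; code labels are shifted by one because label
-- 0 is taken by {0}. The largest value `suc (length c)` looks up position `length c`, past the end,
-- where `blockLabel` defaults to the last block.
labelOf : List (Maybe ℕ) → ℕ → ℕ
labelOf c zero = 0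
labelOf c (suc t) = blockLabel (topLabel c) c t

module _ {K : ℕ} where

  blockLabel-just : ∀ {c t a} → Positions c t a → blockLabel K c t ≡ suc a
  blockLabel-just here = refl
  blockLabel-just (there p) = blockLabel-just p

  blockLabel-cases : ∀ c t → blockLabel K c t ≡ K ⊎ ∃[ a ] Positions c t a × blockLabel K c t ≡ suc a
  blockLabel-cases [] t = inj₁ refl
  blockLabel-cases (just a ∷ c) zero = inj₂ (a , here , refl)
  blockLabel-cases (nothing ∷ c) zero = inj₁ refl
  blockLabel-cases (x ∷ c) (suc t) with blockLabel-cases c t
  ... | inj₁ e = inj₁ e
  ... | inj₂ (a , p , e) = inj₂ (a , there p , e)

  blockLabel-end : ∀ c → blockLabel K c (length c) ≡ K
  blockLabel-end [] = refl
  blockLabel-end (x ∷ c) = blockLabel-end c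

  -- Labels coming from `just` stay below `K`, so `K` marks exactly the entries `nothing`.
  blockLabel-injective : ∀ {c c′} → length c ≡ length c′ →
    (∀ {t a} → Positions c t a → suc a < K) → (∀ {t a} → Positions c′ t a → suc a < K) →
    (∀ t → t < length c → blockLabel K c t ≡ blockLabel K c′ t) → c ≡ c′
  blockLabel-injective {[]} {[]} _ _ _ _ = refl
  blockLabel-injective {x ∷ c} {y ∷ c′} len h h′ eq = cong₂ _∷_
    (head≡ x y (h ∘ at-head) (h′ ∘ at-head) (eq 0 z<s))
    (blockLabel-injective (suc-injective len) (h ∘ there) (h′ ∘ there) λ t t< → eq (suc t) (s<s t<))
    where
    at-head : ∀ {x : Maybe ℕ} {c a} → x ≡ just a → Positions (x ∷ c) 0 a
    at-head refl = here
    head≡ : ∀ x y → (∀ {a} → x ≡ just a → suc a < K) → (∀ {a} → y ≡ just a → suc a < K) →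
            maybe′ suc K x ≡ maybe′ suc K y → x ≡ y
    head≡ (just a) (just .a) _ _ refl = refl
    head≡ (just a) nothing p _ e = ⊥-elim (<-irrefl e (p refl))
    head≡ nothing (just a) _ q e = ⊥-elim (<-irrefl (sym e) (q refl))
    head≡ nothing nothing _ _ _ = refl

positions-bounded : ∀ {c t a} → Positions c t a → suc a < topLabel c
positions-bounded p = s<s (∈⇒<nBlocks (↦⇒∈ (↦-catMaybes⁺ p)))

labelOf-injective : ∀ {c c′ n} → length c ≡ n → length c′ ≡ n → topLabel c ≡ topLabel c′ →
                    (∀ {v} → v < suc n → labelOf c v ≡ labelOf c′ v) → c ≡ c′
labelOf-injective {c} {c′} refl len K≡ eq = blockLabel-injective {topLabel c} (sym len) positions-bounded
  (λ {_} {a} p → subst (suc a <_) (sym K≡) (positions-bounded p))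
  λ t t< → trans (eq (s<s t<)) (cong (λ K → blockLabel K c′ t) (sym K≡))

labelOf-valid : ∀ {c} → StronglyMonotone (catMaybes c [_]↦_) → Valid (2 + length c) (labelOf c) (topLabel c)
labelOf-valid {c} sm = record
  { lab-0 = refl
  ; lab≡0 = lab≡0
  ; lab≤K = λ {v} _ → lab≤K v
  ; lab-top = blockLabel-end c
  ; minima-increase = λ _ → minima-increase
  ; maxima-increase = maxima-increase
  }
  where
  K = topLabel c
  open StronglyMonotone (catMaybes⇒positions {c} sm)
  lab≡0 : ∀ {v} → v < _ → labelOf c v ≡ 0 → v ≡ 0
  lab≡0 {zero} _ _ = refl
  lab≡0 {suc t} _ e with blockLabel-cases {K} c t
  ... | inj₁ e′ with () ← trans (sym e) e′
  ... | inj₂ (_ , _ , e′) with () ← trans (sym e) e′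
  lab≤K : ∀ v → labelOf c v ≤ K
  lab≤K zero = z≤n
  lab≤K (suc t) with blockLabel-cases {K} c t
  ... | inj₁ e = ≤-reflexive e
  ... | inj₂ (a , p , e) = ≤-trans (≤-reflexive e) (<⇒≤ (positions-bounded p))
  minima-increase : ∀ {v a} → labelOf c v ≡ suc a → suc a < K → ∃[ u ] u < v × labelOf c u ≡ a
  minima-increase {suc t} {a} e lt with blockLabel-cases {K} c t
  ... | inj₁ e′ = ⊥-elim (<-irrefl (trans (sym e) e′) lt)
  ... | inj₂ (a′ , p , e′) with a | suc-injective (trans (sym e) e′)
  -- Below the first block of the code lies {0}.
  ...   | zero | _ = 0 , z<s , refl
  ...   | suc b | refl = let s , s<t , q = minima p in suc s , s<s s<t , blockLabel-just q
  used : ∀ {b} → b < nBlocks (catMaybes c) → ∃[ t ] Positions c t b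
  used b< = let _ , p = stronglyMonotone-used sm b< ; t , q , _ = ↦-catMaybes⁻ c p in t , q
  maxima-increase : ∀ {v} → v < 2 + length c → labelOf c v < K →
       ∃[ u ] v < u × u < 2 + length c × labelOf c u ≡ suc (labelOf c v)
  maxima-increase {zero} _ lt with m≤n⇒m<n∨m≡n {0} {nBlocks (catMaybes c)} z≤n
  -- After {0} comes the block with code label 0, or, if the code has no labels, the last block,
  -- which contains the largest value.
  ... | inj₁ 0<k = let t , p = used 0<k in suc t , z<s , s<s (m<n⇒m<1+n (↦⇒< p)) , blockLabel-just p
  ... | inj₂ 0≡k = suc (length c) , z<s , ≤-refl , trans (blockLabel-end c) (cong suc (sym 0≡k))
  maxima-increase {suc t} (s≤s t<) lt with blockLabel-cases {K} c t
  ... | inj₁ e = ⊥-elim (<-irrefl e lt)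
  ... | inj₂ (a , p , e) with m≤n⇒m<n∨m≡n (≤-pred (positions-bounded p))
  -- After the largest code label comes the last block, where the largest value serves as witness.
  ...   | inj₂ e′ =
          suc (length c) , s<s (↦⇒< p) , ≤-refl , trans (blockLabel-end c) (cong suc (trans (sym e′) (sym e)))
  ...   | inj₁ sa< with maxima p (proj₂ (used sa<))
  ...     | u , t<u , q = suc u , s<s t<u , s<s (m<n⇒m<1+n (↦⇒< q)) , trans (blockLabel-just q) (cong suc (sym e))

↦-applyUpTo⁺ : ∀ (g : ℕ → X) {n t} → t < n → applyUpTo g n [ t ]↦ g t
↦-applyUpTo⁺ g {suc n} {zero} _ = here
↦-applyUpTo⁺ g {suc n} {suc t} (s≤s t<n) = there (↦-applyUpTo⁺ (g ∘ suc) t<n)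

↦-applyUpTo⁻ : ∀ (g : ℕ → X) n {t x} → applyUpTo g n [ t ]↦ x → t < n × x ≡ g t
↦-applyUpTo⁻ g (suc n) here = z<s , refl
↦-applyUpTo⁻ g (suc n) (there p) = let a , b = ↦-applyUpTo⁻ (g ∘ suc) n p in s<s a , b

blockLabel-applyUpTo : ∀ {K} (g : ℕ → Maybe ℕ) {n t} → t < n →
                       blockLabel K (applyUpTo g n) t ≡ maybe′ suc K (g t)
blockLabel-applyUpTo g {suc n} {zero} _ = refl
blockLabel-applyUpTo g {suc n} {suc t} (s≤s t<n) = blockLabel-applyUpTo (g ∘ suc) t<n

-- From a labelled partition to its code

module Encode {N lab K} (valid : Valid (2 + N) lab K) where
  open Valid valid

  private
    entry : ℕ → Maybe ℕ
    entry t with lab (suc t) ≟ K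
    ... | yes _ = nothing
    ... | no _ = just (pred (lab (suc t)))

    -- Only the value 0 has label 0, so taking predecessors loses nothing.
    lab-suc : ∀ {t} → t ≤ N → suc (pred (lab (suc t))) ≡ lab (suc t)
    lab-suc {t} t≤N with lab (suc t) in e
    ... | suc _ = refl
    ... | zero with () ← lab≡0 (s<s (s≤s t≤N)) e

    maybe-entry : ∀ {t} → t ≤ N → maybe′ suc K (entry t) ≡ lab (suc t)
    maybe-entry {t} t≤N with lab (suc t) ≟ K
    ... | yes e = sym e
    ... | no _ = lab-suc t≤N

  code : List (Maybe ℕ)
  code = applyUpTo entry N

  length-code : length code ≡ N
  length-code = length-applyUpTo entry N

  private
    entry⁻ : ∀ {t a} → t ≤ N → just a ≡ entry t → lab (suc t) ≡ suc a × suc a < K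
    entry⁻ {t} t≤N e with lab (suc t) ≟ K
    entry⁻ {t} t≤N refl | no ne = sym (lab-suc t≤N)
      , ≤∧≢⇒< (≤-trans (≤-reflexive (lab-suc t≤N)) (lab≤K (s<s (s≤s t≤N)))) λ e → ne (trans (sym (lab-suc t≤N)) e)

    entry⁺ : ∀ {t a} → lab (suc t) ≡ suc a → suc a < K → entry t ≡ just a
    entry⁺ {t} e lt with lab (suc t) ≟ K
    ... | yes e′ = ⊥-elim (<-irrefl (trans (sym e) e′) lt)
    ... | no _ = cong (just ∘ pred) e

    positions⁻ : ∀ {t a} → Positions code t a → t < N × lab (suc t) ≡ suc a × suc a < K
    positions⁻ p = let t<N , e = ↦-applyUpTo⁻ entry N p in t<N , entry⁻ (<⇒≤ t<N) e

    positions⁺ : ∀ {t a} → t ≤ N → lab (suc t) ≡ suc a → suc a < K → Positions code t a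
    positions⁺ {t} t≤N e lt with m≤n⇒m<n∨m≡n t≤N
    ... | inj₁ t<N = subst (code [ t ]↦_) (entry⁺ e lt) (↦-applyUpTo⁺ entry t<N)
    -- Position `N` stands for the largest value, which is in the last block.
    ... | inj₂ refl = ⊥-elim (<-irrefl (trans (sym e) lab-top) lt)

    minima : ∀ {t b} → Positions code t (suc b) → ∃[ s ] s < t × Positions code s b
    minima {t} p with positions⁻ p
    ... | t<N , e , lt with minima-increase (s<s (m<n⇒m<1+n t<N)) e lt
    ...   | zero , _ , e′ with () ← trans (sym lab-0) e′
    ...   | suc s , s≤s s<t , e′ = s , s<t , positions⁺ (<⇒≤ (<-trans s<t t<N)) e′ (<-trans (n<1+n _) lt)

    maxima : ∀ {t t′ a} → Positions code t a → Positions code t′ (suc a) → ∃[ u ] t < u × Positions code u (suc a)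
    maxima p p′ with positions⁻ p | positions⁻ p′
    ... | t<N , e , lt | _ , _ , lt′ with maxima-increase (s<s (m<n⇒m<1+n t<N)) (subst (_< K) (sym e) lt)
    ...   | suc u , s≤s t<u , s≤s (s≤s u≤N) , e′ = u , t<u , positions⁺ u≤N (trans e′ (cong suc e)) lt′

  code-positions : StronglyMonotone (Positions code)
  code-positions = record { minima = minima ; maxima = maxima }

  -- Labels in the code come from blocks below `K`, which bounds their number from above.
  -- Conversely, climbing from the value 0 reaches block `K ∸ 1`, so the code uses its label. The
  -- case `K ≡ 0` would put the largest value into {0}.
  code-topLabel : topLabel code ≡ K
  code-topLabel = from-suc K refl
    where
    upper : ∀ {k} → K ≡ suc k → nBlocks (catMaybes code) ≤ k
    upper eK with nBlocks (catMaybes code) in e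
    ... | zero = z≤n
    ... | suc s with ∈⇒↦ (nBlocks-attained (catMaybes code) e)
    ...   | _ , p with ↦-catMaybes⁻ code p
    ...     | _ , q , _ = ≤-pred (subst (suc s <_) eK (proj₂ (proj₂ (positions⁻ q))))
    lower : ∀ k → K ≡ suc k → k ≤ nBlocks (catMaybes code)
    lower zero _ = z≤n
    lower (suc k) eK with higher-block-larger valid {0} (suc k) z<s (≤-trans (≤-reflexive (cong suc lab-0)) z<s)
                            (≤-trans (n≤1+n _) (≤-reflexive (sym eK)))
    ... | suc t , _ , s≤s (s≤s t≤N) , e =
          ∈⇒<nBlocks (↦⇒∈ (↦-catMaybes⁺ (positions⁺ t≤N e (≤-reflexive (sym eK)))))
    from-suc : ∀ k → K ≡ k → topLabel code ≡ k
    from-suc zero eK with () ← lab≡0 {suc N} ≤-refl (trans lab-top eK)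
    from-suc (suc k) eK = cong suc (≤-antisym (upper eK) (lower k eK))

  labelOf-code : ∀ {v} → v < 2 + N → labelOf code v ≡ lab v
  labelOf-code {zero} _ = sym lab-0
  labelOf-code {suc t} (s≤s (s≤s t≤N)) rewrite code-topLabel with m≤n⇒m<n∨m≡n t≤N
  ... | inj₁ t<N = trans (blockLabel-applyUpTo entry t<N) (maybe-entry t≤N)
  ... | inj₂ refl = trans (subst (λ l → blockLabel K code l ≡ K) length-code (blockLabel-end code)) (sym lab-top)

-- Enumerating and counting the codes

insertions : ℕ → List X → List (List (Maybe X))
insertions zero [] = [] ∷ []
insertions zero (_ ∷ _) = []
insertions (suc n) [] = map (nothing ∷_) (insertions n [])
insertions (suc n) (x ∷ xs) = map (nothing ∷_) (insertions n (x ∷ xs)) ++ map (just x ∷_) (insertions n xs)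

-- `insertions n xs` lists the lists of length `n` whose `catMaybes` is `xs`; splitting by the first
-- entry is Pascal's rule.
length-insertions : ∀ n (xs : List X) → length (insertions n xs) ≡ n C length xs
length-insertions zero [] = refl
length-insertions zero (_ ∷ xs) = sym (k>n⇒nCk≡0 {0} {suc (length xs)} z<s)
length-insertions (suc n) [] = trans (length-map _ (insertions n []))
  (trans (length-insertions n []) (trans (nC0≡1 n) (sym (nC0≡1 (suc n)))))
  where
  nC0≡1 : ∀ n → n C 0 ≡ 1
  nC0≡1 n = trans (nCk≡nC[n∸k] {0} {n} z≤n) (nCn≡1 n)
length-insertions (suc n) (x ∷ xs) = trans (length-++ (map (nothing ∷_) (insertions n (x ∷ xs))))
  (trans (cong₂ _+_ (trans (length-map _ (insertions n (x ∷ xs))) (length-insertions n (x ∷ xs)))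
                    (trans (length-map _ (insertions n xs)) (length-insertions n xs)))
    (trans (+-comm (n C suc (length xs)) _) (nCk+nC[k+1]≡[n+1]C[k+1] n (length xs))))

∈-insertions⁺ : ∀ {n} (c : List (Maybe X)) → length c ≡ n → c ∈ insertions n (catMaybes c)
∈-insertions⁺ [] refl = here refl
∈-insertions⁺ (just x ∷ c) refl = ∈-++⁺ʳ (map (nothing ∷_) (insertions (length c) (x ∷ catMaybes c)))
  (∈-map⁺ (just x ∷_) (∈-insertions⁺ c refl))
∈-insertions⁺ (nothing ∷ c) refl with catMaybes c | ∈-insertions⁺ c refl
... | [] | p = ∈-map⁺ (nothing ∷_) p
... | x ∷ xs | p = ∈-++⁺ˡ (∈-map⁺ (nothing ∷_) p)

∈-insertions⁻ : ∀ n (xs : List X) {c} → c ∈ insertions n xs → length c ≡ n × catMaybes c ≡ xs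
∈-insertions⁻ zero [] (here refl) = refl , refl
∈-insertions⁻ (suc n) [] p with ∈-map⁻ (nothing ∷_) p
... | c , q , refl = let a , b = ∈-insertions⁻ n [] q in cong suc a , b
∈-insertions⁻ (suc n) (x ∷ xs) p with ∈-++⁻ (map (nothing ∷_) (insertions n (x ∷ xs))) p
... | inj₁ p′ with ∈-map⁻ (nothing ∷_) p′
...   | c , q , refl = let a , b = ∈-insertions⁻ n (x ∷ xs) q in cong suc a , b
∈-insertions⁻ (suc n) (x ∷ xs) p | inj₂ p′ with ∈-map⁻ (just x ∷_) p′
...   | c , q , refl = let a , b = ∈-insertions⁻ n xs q in cong suc a , cong (x ∷_) b

insertions-unique : ∀ n (xs : List X) → Unique (insertions n xs)
insertions-unique zero [] = [] ∷ []
insertions-unique zero (_ ∷ _) = []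
insertions-unique (suc n) [] = Uniqueₚ.map⁺ (proj₂ ∘ ∷-injective) (insertions-unique n [])
insertions-unique (suc n) (x ∷ xs) = Uniqueₚ.++⁺
  (Uniqueₚ.map⁺ (proj₂ ∘ ∷-injective) (insertions-unique n (x ∷ xs)))
  (Uniqueₚ.map⁺ (proj₂ ∘ ∷-injective) (insertions-unique n xs))
  λ (p , q) → nothing≢just (∈-map⁻ (nothing ∷_) p) (∈-map⁻ (just x ∷_) q)
  where
  nothing≢just : ∀ {c} → ∃[ d ] d ∈ insertions n (x ∷ xs) × c ≡ nothing ∷ d →
                 ∃[ d ] d ∈ insertions n xs × c ≡ just x ∷ d → ⊥
  nothing≢just (_ , _ , refl) (_ , _ , ())

length-concatMap : ∀ (f : X → List Y) xs → length (concatMap f xs) ≡ sum (map (length ∘ f) xs)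
length-concatMap f [] = refl
length-concatMap f (x ∷ xs) = trans (length-++ (f x)) (cong (length (f x) +_) (length-concatMap f xs))

length-concatMap-const : ∀ (f : X → List Y) k xs → (∀ {x} → x ∈ xs → length (f x) ≡ k) →
                         length (concatMap f xs) ≡ k * length xs
length-concatMap-const f k [] _ = sym (*-zeroʳ k)
length-concatMap-const f k (x ∷ xs) h = trans (length-++ (f x))
  (trans (cong₂ _+_ (h (here refl)) (length-concatMap-const f k xs (h ∘ there))) (sym (*-suc k (length xs))))

-- `A i` is the length of this list by definition.
smWords : ℕ → List (List ℕ)
smWords i = filterᵇ (λ w → isRGS w ∧ isStronglyMonotone w) (words i i)

∈-smWords⁺ : ∀ {w} → StronglyMonotone (w [_]↦_) → w ∈ smWords (length w)
∈-smWords⁺ {w} sm = ∈-filterᵇ⁺ (∈-words⁺ (length w) refl bounded) (stronglyMonotone⇒sm sm)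
  where
  bounded : ∀ {x} → x ∈ w → x < length w
  bounded x∈ = let _ , p = ∈⇒↦ x∈ in ≤-<-trans (StronglyMonotone.label≤index sm _ p) (↦⇒< p)

∈-smWords⁻ : ∀ {i w} → w ∈ smWords i → length w ≡ i × StronglyMonotone (w [_]↦_)
∈-smWords⁻ {i} w∈ = let w∈words , h = ∈-filterᵇ⁻ w∈ in proj₁ (∈-words⁻ i w∈words) , sm⇒stronglyMonotone h

-- The index `i` is the number of values outside {0} and the last block, so the lengths of the
-- pieces are the summands of `binomA n`.
codes : ℕ → List (List (Maybe ℕ))
codes n = concatMap (λ i → concatMap (insertions n) (smWords i)) (upTo (suc n))

∈-codes-block⁻ : ∀ n i {c} → c ∈ concatMap (insertions n) (smWords i) →
                 length c ≡ n × length (catMaybes c) ≡ i × StronglyMonotone (catMaybes c [_]↦_)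
∈-codes-block⁻ n i c∈ with find (∈-concatMap⁻ (insertions n) {xs = smWords i} c∈)
... | w , w∈ , c∈′ with ∈-insertions⁻ n w c∈′ | ∈-smWords⁻ {i} w∈
...   | len , refl | len′ , sm = len , len′ , sm

∈-codes⁻ : ∀ {n c} → c ∈ codes n → length c ≡ n × StronglyMonotone (catMaybes c [_]↦_)
∈-codes⁻ {n} c∈ with find (∈-concatMap⁻ (λ i → concatMap (insertions n) (smWords i)) {xs = upTo (suc n)} c∈)
... | i , _ , c∈′ = let len , _ , sm = ∈-codes-block⁻ n i c∈′ in len , sm

∈-codes⁺ : ∀ {n c} → length c ≡ n → StronglyMonotone (catMaybes c [_]↦_) → c ∈ codes n
∈-codes⁺ {c = c} refl sm = ∈-concatMap⁺ _ (lose (∈-upTo⁺ (s<s (length-catMaybes c)))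
  (∈-concatMap⁺ (insertions (length c)) (lose (∈-smWords⁺ sm) (∈-insertions⁺ c refl))))

-- A code determines its word through `catMaybes`, and the word determines `i` by its length, so
-- nothing is listed twice.
codes-unique : ∀ n → Unique (codes n)
codes-unique n = concatMap-unique (Uniqueₚ.upTo⁺ (suc n))
  (λ i → concatMap-unique (filterᵇ-unique _ (words-unique i)) (insertions-unique n)
    λ p q → trans (sym (proj₂ (∈-insertions⁻ n _ p))) (proj₂ (∈-insertions⁻ n _ q)))
  λ p q → trans (sym (proj₁ (proj₂ (∈-codes-block⁻ n _ p)))) (proj₁ (proj₂ (∈-codes-block⁻ n _ q)))

length-codes : ∀ n → length (codes n) ≡ binomA n
length-codes n = trans (length-concatMap (λ i → concatMap (insertions n) (smWords i)) (upTo (suc n)))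
  (cong sum (map-cong
  (λ i → length-concatMap-const (insertions n) (n C i) (smWords i)
    λ {w} w∈ → trans (length-insertions n w) (cong (n C_) (proj₁ (∈-smWords⁻ {i} w∈)))) (upTo (suc n))))

-- Sorting the values by label

module _ (lab : ℕ → ℕ) where

  insertBefore : ∀ {n} w → AllPairs (Before lab) w → (∀ {x} → x ∈ w → n ≢ x) →
    ∃[ v ] length v ≡ suc (length w) × AllPairs (Before lab) v × (∀ {x} → x ∈ v → x ≡ n ⊎ x ∈ w)
  insertBefore {n} [] _ _ = n ∷ [] , refl , [] ∷ [] , λ { (here e) → inj₁ e }
  insertBefore {n} (y ∷ w) (y< ∷ sorted) ≢n with before-total {lab} n y (≢n (here refl))
  ... | inj₁ n<y = n ∷ y ∷ w , refl , (n<y ∷ All.map (before-trans n<y) y<) ∷ y< ∷ sorted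
                 , λ { (here e) → inj₁ e ; (there p) → inj₂ p }
  ... | inj₂ y<n with insertBefore w sorted (≢n ∘ there)
  ...   | v , len , sorted′ , from-w = y ∷ v , cong suc len
          , All.tabulate (λ x∈ → y-before (from-w x∈)) ∷ sorted′
          , λ { (here e) → inj₂ (here e) ; (there p) → map₂ there (from-w p) }
    where
    y-before : ∀ {x} → x ≡ n ⊎ x ∈ w → Before lab y x
    y-before (inj₁ refl) = y<n
    y-before (inj₂ x∈) = All.lookup y< x∈

  -- Insertion sort of the values below `n`. That all of them appear follows by pigeonhole from the
  -- length, the bound and the distinctness implied by sortedness.
  sortedWord : ∀ n → ∃[ w ] length w ≡ n × AllPairs (Before lab) w × (∀ {x} → x ∈ w → x < n)
  sortedWord zero = [] , refl , [] , λ ()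
  sortedWord (suc n) with sortedWord n
  ... | w , refl , sorted , bounded with insertBefore w sorted (λ x∈ e → <-irrefl (sym e) (bounded x∈))
  ...   | v , len , sorted′ , from-w = v , len , sorted′ , bounded′ ∘ from-w
    where
    bounded′ : ∀ {x} → x ≡ length w ⊎ x ∈ w → x < suc (length w)
    bounded′ (inj₁ refl) = ≤-refl
    bounded′ (inj₂ x∈) = m<n⇒m<1+n (bounded x∈)

module _ {lab : ℕ → ℕ} where

  sorted⇒unique : ∀ {w} → AllPairs (Before lab) w → Unique w
  sorted⇒unique = AllPairs.map λ { b refl → before-irrefl b }

  -- If the heads differed, each would occur in the tail of the other list, so each would come
  -- before the other.
  sorted-≡ : ∀ {w v} → AllPairs (Before lab) w → AllPairs (Before lab) v →
             (∀ {x} → x ∈ w → x ∈ v) → (∀ {x} → x ∈ v → x ∈ w) → w ≡ v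
  sorted-≡ [] [] _ _ = refl
  sorted-≡ [] (_ ∷ _) _ g with () ← g (here refl)
  sorted-≡ (_ ∷ _) [] f _ with () ← f (here refl)
  sorted-≡ {x ∷ w} {y ∷ v} (x< ∷ ws) (y< ∷ vs) f g with f (here refl) | g (here refl)
  ... | there x∈ | there y∈ = ⊥-elim (before-asym (All.lookup x< y∈) (All.lookup y< x∈))
  ... | here refl | _ = cong (x ∷_) (sorted-≡ ws vs (drop-head x< f) (drop-head y< g))
    where
    drop-head : ∀ {w v} → All (Before lab x) w → (∀ {z} → z ∈ x ∷ w → z ∈ x ∷ v) → ∀ {z} → z ∈ w → z ∈ v
    drop-head x< f z∈ with f (there z∈)
    ... | there z∈′ = z∈′
    ... | here refl = ⊥-elim (before-irrefl (All.lookup x< z∈))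
  ... | there x∈ | here refl = ⊥-elim (before-irrefl (All.lookup y< x∈))

-- The correspondence between avoiders and codes

before-cong : ∀ {lab lab′ u v} → lab u ≡ lab′ u → lab v ≡ lab′ v → Before lab u v → Before lab′ u v
before-cong p q (lower-block r) = lower-block (subst₂ _<_ p q r)
before-cong p q (same-block e r) = same-block (trans (sym p) (trans e q)) r

SortedBy : List ℕ → List (Maybe ℕ) → Set
SortedBy w c = AllPairs (Before (labelOf c)) w

-- The code is that of the partition into decreasing runs.
avoider⇒code : ∀ {N w} → w ∈ avoiders (2 + N) → ∃[ c ] c ∈ codes N × SortedBy w c
avoider⇒code {N} {w} w∈ with ∈-avoiders⁻ {2 + N} {w} w∈
... | len , w! , bounded , good = code
    , ∈-codes⁺ length-code (positions⇒catMaybes code-positions)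
    , AllPairs-at⁺ w λ {i} {j} i<j j< →
        let j<n = subst (j <_) len j<
        in before-cong (sym (labelOf-code (f<n (<-trans i<j j<n)))) (sym (labelOf-code (f<n j<n))) (sorted i<j j<n)
  where
  bij : IsBijection (2 + N) (at w)
  bij = subst (λ n → IsBijection n (at w)) len (unique⇒bijection w! bounded)
  open IsBijection bij
  open Good⇒Valid bij (subst (λ n → Good n (at w)) len good) z<s
  open Encode valid

code⇒avoider : ∀ {N c} → c ∈ codes N → ∃[ w ] w ∈ avoiders (2 + N) × SortedBy w c
code⇒avoider {N} {c} c∈ with ∈-codes⁻ {N} {c} c∈
... | refl , sm with sortedWord (labelOf c) (2 + N)
...   | w , len , sorted , bounded =
        w , subst (λ n → w ∈ avoiders n) len (∈-avoiders⁺ {w} 0<length w! bounded′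
              (Sorted⇒Good.good (unique⇒bijection w! bounded′) valid (AllPairs-at⁻ sorted) 0<length))
          , sorted
  where
  w! = sorted⇒unique sorted
  bounded′ : ∀ {x} → x ∈ w → x < length w
  bounded′ x∈ = subst (_ <_) (sym len) (bounded x∈)
  0<length = subst (0 <_) (sym len) z<s
  valid : Valid (length w) (labelOf c) (topLabel c)
  valid = subst (λ n → Valid n (labelOf c) (topLabel c)) (sym len) (labelOf-valid sm)

-- Both words consist of all values below `2 + N`, and these have only one sorted arrangement.
SortedBy-functionalˡ : ∀ {N w v c} → w ∈ avoiders (2 + N) → v ∈ avoiders (2 + N) →
                       SortedBy w c → SortedBy v c → w ≡ v
SortedBy-functionalˡ {N} {w} {v} w∈ v∈ s s′
  with ∈-avoiders⁻ {2 + N} {w} w∈ | ∈-avoiders⁻ {2 + N} {v} v∈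
... | len , w! , bounded , _ | len′ , v! , bounded′ , _ = sorted-≡ s s′
  (λ x∈ → unique-bounded⇒∈ v! bounded′ (subst (_ <_) (trans len (sym len′)) (bounded x∈)))
  (λ x∈ → unique-bounded⇒∈ w! bounded (subst (_ <_) (trans len′ (sym len)) (bounded′ x∈)))

-- Both labellings can be read off the word as its run index, so they agree.
SortedBy-functionalʳ : ∀ {N w c d} → w ∈ avoiders (2 + N) → c ∈ codes N → d ∈ codes N →
                       SortedBy w c → SortedBy w d → c ≡ d
SortedBy-functionalʳ {N} {w} {c} {d} w∈ c∈ d∈ s s′
  with ∈-avoiders⁻ {2 + N} {w} w∈ | ∈-codes⁻ {N} {c} c∈ | ∈-codes⁻ {N} {d} d∈
... | len , w! , bounded , _ | refl , sm | len′ , sm′ =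
  labelOf-injective refl len′
    -- Both top labels are the label of the largest value.
    (trans (sym (Valid.lab-top valid-c)) (trans (labels ≤-refl) (Valid.lab-top valid-d)))
    λ v< → labels (m<n⇒m<1+n v<)
  where
  bij : IsBijection (2 + N) (at w)
  bij = subst (λ n → IsBijection n (at w)) len (unique⇒bijection w! bounded)
  open IsBijection bij
  valid-c = labelOf-valid {c} sm
  valid-d : Valid (2 + N) (labelOf d) (topLabel d)
  valid-d = subst (λ n → Valid (2 + n) (labelOf d) (topLabel d)) len′ (labelOf-valid {d} sm′)
  at-sorted : ∀ {c} → SortedBy w c → ∀ {i j} → i < j → j < 2 + N → Before (labelOf c) (at w i) (at w j)
  at-sorted s {j = j} i<j j< = AllPairs-at⁻ s i<j (subst (j <_) (sym len) j<)
  labels : ∀ {v} → v < 2 + N → labelOf c v ≡ labelOf d v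
  labels {v} v< = subst (λ u → labelOf c u ≡ labelOf d u) (f-pos v<)
    (trans (Sorted⇒Good.lab≡runIndex bij valid-c (at-sorted s) z<s (pos v) (pos<n v<))
      (sym (Sorted⇒Good.lab≡runIndex bij valid-d (at-sorted s′) z<s (pos v) (pos<n v<))))

theorem5p12 : ∀ (n : ℕ) → 2 ≤ n → numAvCyc-23-14 n ≡ binomA (n ∸ 2)
theorem5p12 (suc (suc N)) _ = trans
  (correspondence⇒length≡ {R = SortedBy} (avoiders-unique (2 + N)) (codes-unique N)
    (avoider⇒code {N}) (code⇒avoider {N})
    (λ p q _ → SortedBy-functionalˡ {N} p q) (λ p q r → SortedBy-functionalʳ {N} p q r))
  (length-codes N)
theorem5p12 (suc zero) (s≤s ())
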